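{- Let $q$ be a prime power, $n$ a positive integer, and let $f\in\mathcal{L}_{n,q}$ with $f\notin\langle x\rangle_{\mathbb{F}_{q^n}}$. Let $\mathcal{C}_f=\langle x,f\rangle_{\mathbb{F}_{q^n}}\subseteq\mathcal{L}_{n,q}$ be the associated rank-metric code. Then the $\mathbb{F}_q$-algebras $\mathbb{S}_f$ and $R(\mathcal{C}_f)$ are isomorphic.
   Context: $\mathcal{L}_{n,q}$ is the $\mathbb{F}_q$-algebra (with sum, composition $\circ$, and multiplication by scalars in $\mathbb{F}_q$) of $q$-polynomials over $\mathbb{F}_{q^n}$ modulo $x^{q^n}-x$, i.e. polynomials $\sum_{i=0}^{n-1}a_ix^{q^i}$ with $a_i\in\mathbb{F}_{q^n}$, identified with the $\mathbb{F}_q$-linear endomorphisms of $\mathbb{F}_{q^n}$. $\langle x\rangle_{\mathbb{F}_{q^n}}=\{ax : a\in\mathbb{F}_{q^n}\}$ and $\langle x,f\rangle_{\mathbb{F}_{q^n}}=\{ax+bf : a,b\in\mathbb{F}_{q^n}\}$. The graph of $f$ is $\mathcal{G}_f=\{(y,f(y)) : y\in\mathbb{F}_{q^n}\}$, and $\mathbb{S}_f=\{A\in\mathbb{F}_{q^n}^{2\times2} : A\mathcal{G}_f\subseteq\mathcal{G}_f\}$ with $A\mathcal{G}_f=\left\{A\begin{pmatrix}y\\ f(y)\end{pmatrix} : y\in\mathbb{F}_{q^n}\right\}$; it is an $\mathbb{F}_q$-algebra under matrix sum, matrix product and multiplication by scalars in $\mathbb{F}_q$. The right idealizer of an $\mathbb{F}_q$-subspace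 $\mathcal{C}\subseteq\mathcal{L}_{n,q}$ is $R(\mathcal{C})=\{g\in\mathcal{L}_{n,q} : h\circ g\in\mathcal{C}\text{ for all }h\in\mathcal{C}\}$, an $\mathbb{F}_q$-algebra under sum, composition and multiplication by scalars in $\mathbb{F}_q$. -}

module Defs where

open import Level using (Level; _⊔_) renaming (suc to lsuc)
open import Algebra.Bundles using (Ring; CommutativeRing)
open import Algebra.Module.Structures using (IsPreleftSemimodule)
open import Algebra.Morphism.Structures using (IsRingHomomorphism; IsRingIsomorphism)
open import Algebra.Structures using (IsRing)
import Algebra.Construct.Pointwise as Pointwise
import Algebra.Properties.CommutativeMonoid.Sum as MonoidSum
import Algebra.Properties.CommutativeSemiring.Binomial as Binomial
import Algebra.Properties.CommutativeSemiring.Exp as Exponentiation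
import Algebra.Properties.Group as GroupProperties
import Algebra.Properties.Ring as RingProperties
import Algebra.Properties.Semiring.Mult as Multiplication
import Algebra.Properties.Semiring.Sum as SemiringSum
open import Data.Bool.Base using (if_then_else_; true; false)
open import Data.Empty using (⊥-elim)
open import Data.Fin.Base using (Fin; zero; suc; toℕ; inject₁; fromℕ; punchIn)
open import Data.Fin.Permutation using (Permutation′; permutation)
import Data.Fin.Properties as Fin
open import Data.Nat.Base as ℕ using (ℕ; zero; suc; NonZero)
open import Data.Nat.Combinatorics using (_C_; nCn≡1; nC1≡n; nCk+nC[k+1]≡[n+1]C[k+1]; k>n⇒nCk≡0)
open import Data.Nat.Divisibility using (_∣_; divides; ∣⇒≤)
open import Data.Nat.DivMod using (_mod_; _%_; _/_; m%n<n; m<n⇒m%n≡m; m%n%n≡m%n; m≡m%n+[m/n]*n; %-distribˡ-+)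
open import Data.Nat.Primality using (Prime; euclidsLemma; prime⇒nonZero)
import Data.Nat.Properties as ℕ
open import Data.Product.Base using (∃; ∃-syntax; _×_; _,_; proj₁; proj₂)
open import Data.Sum.Base using (inj₁; inj₂)
open import Data.Vec.Functional using (Vector; _∷_; []; removeAt; replicate)
open import Function.Base using (_on_)
open import Function.Bundles using (Inverse)
open import Relation.Binary.Core using (_Preserves_⟶_)
open import Relation.Binary.PropositionalEquality as ≡ using (_≡_; _≢_)
import Relation.Binary.Reasoning.Setoid as SetoidReasoning
open import Relation.Nullary using (Dec; yes; no; does)
import Relation.Nullary.Decidable as Dec
open import Relation.Unary using (Pred; _∈_; _⊆_)

private
  variable
    r ℓr a ℓa b ℓb p : Level

IsPrimePower : ℕ → Set
IsPrimePower q = ∃[ p ] ∃[ k ] (Prime p × 1 ℕ.≤ k × q ≡ p ℕ.^ k)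

record Algebra (R : CommutativeRing r ℓr) (a ℓa : Level) : Set (r ⊔ ℓr ⊔ lsuc (a ⊔ ℓa)) where
  private module R = CommutativeRing R
  infixr 7 _·_
  field
    ring : Ring a ℓa
  open Ring ring public
  field
    _·_                 : R.Carrier → Carrier → Carrier
    isPreleftSemimodule : IsPreleftSemimodule R.semiring _≈_ _+_ 0# _·_
    ·-*-assocˡ          : ∀ s x y → (s · x) * y ≈ s · (x * y)
    ·-*-assocʳ          : ∀ s x y → x * (s · y) ≈ s · (x * y)
  open IsPreleftSemimodule isPreleftSemimodule public
    renaming ( *ₗ-cong to ·-cong; *ₗ-zeroˡ to ·-zeroˡ; *ₗ-zeroʳ to ·-zeroʳ; *ₗ-assoc to ·-assoc
             ; *ₗ-identityˡ to ·-identityˡ; *ₗ-distribˡ to ·-distribˡ; *ₗ-distribʳ to ·-distribʳ)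

  -1·x≈-x : ∀ x → (R.- R.1#) · x ≈ - x
  -1·x≈-x x = GroupProperties.inverseˡ-unique +-group ((R.- R.1#) · x) x (begin
    (R.- R.1#) · x + x           ≈⟨ +-congˡ (·-identityˡ x) ⟨
    (R.- R.1#) · x + R.1# · x    ≈⟨ ·-distribʳ x (R.- R.1#) R.1# ⟨
    (R.- R.1# R.+ R.1#) · x      ≈⟨ ·-cong (R.-‿inverseˡ R.1#) refl ⟩
    R.0# · x                     ≈⟨ ·-zeroˡ x ⟩
    0#                           ∎)
    where open SetoidReasoning setoid

module _ {R : CommutativeRing r ℓr} where

  record IsAlgebraIsomorphism (A : Algebra R a ℓa) (B : Algebra R b ℓb)
           (φ : Algebra.Carrier A → Algebra.Carrier B) : Set (r ⊔ a ⊔ ℓa ⊔ b ⊔ ℓb) where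
    private
      module A = Algebra A
      module B = Algebra B
    field
      isRingIsomorphism : IsRingIsomorphism A.rawRing B.rawRing φ
      ·-homo            : ∀ s x → φ (s A.· x) B.≈ s B.· φ x

  infix 4 _≅_
  _≅_ : Algebra R a ℓa → Algebra R b ℓb → Set (r ⊔ a ⊔ ℓa ⊔ b ⊔ ℓb)
  A ≅ B = ∃ (IsAlgebraIsomorphism A B)

  module _ (A : Algebra R a ℓa) where
    private
      module R = CommutativeRing R
    open Algebra A

    record IsSubspace (P : Pred Carrier p) : Set (r ⊔ a ⊔ ℓa ⊔ p) where
      field
        resp     : ∀ {x y} → x ≈ y → x ∈ P → y ∈ P
        0-closed : 0# ∈ P
        +-closed : ∀ {x y} → x ∈ P → y ∈ P → x + y ∈ P
        ·-closed : ∀ s {x} → x ∈ P → s · x ∈ P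

    record IsSubalgebra (P : Pred Carrier p) : Set (r ⊔ a ⊔ ℓa ⊔ p) where
      field
        isSubspace : IsSubspace P
        1-closed   : 1# ∈ P
        *-closed   : ∀ {x y} → x ∈ P → y ∈ P → x * y ∈ P
      open IsSubspace isSubspace public

      -‿closed : ∀ {x} → x ∈ P → - x ∈ P
      -‿closed {x} x∈P = resp (-1·x≈-x x) (·-closed (R.- R.1#) x∈P)

    subalgebra : (P : Pred Carrier p) → IsSubalgebra P → Algebra R (a ⊔ p) ℓa
    subalgebra P isSub = record
      { ring = record
        { Carrier = ∃ P
        ; _≈_ = _≈_ on proj₁
        ; _+_ = λ (x , x∈P) (y , y∈P) → x + y , +-closed x∈P y∈P
        ; _*_ = λ (x , x∈P) (y , y∈P) → x * y , *-closed x∈P y∈P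
        ; -_ = λ (x , x∈P) → - x , -‿closed x∈P
        ; 0# = 0# , 0-closed
        ; 1# = 1# , 1-closed
        ; isRing = record
          { +-isAbelianGroup = record
            { isGroup = record
              { isMonoid = record
                { isSemigroup = record
                  { isMagma = record
                    { isEquivalence = record { refl = refl ; sym = sym ; trans = trans }
                    ; ∙-cong = +-cong
                    }
                  ; assoc = λ (x , _) (y , _) (z , _) → +-assoc x y z
                  }
                ; identity = (λ (x , _) → +-identityˡ x) , (λ (x , _) → +-identityʳ x)
                }
              ; inverse = (λ (x , _) → -‿inverseˡ x) , (λ (x , _) → -‿inverseʳ x)
              ; ⁻¹-cong = -‿cong
              }
            ; comm = λ (x , _) (y , _) → +-comm x y
            }
          ; *-cong = *-cong
          ; *-assoc = λ (x , _) (y , _) (z , _) → *-assoc x y z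
          ; *-identity = (λ (x , _) → *-identityˡ x) , (λ (x , _) → *-identityʳ x)
          ; distrib = (λ (x , _) (y , _) (z , _) → distribˡ x y z)
                    , (λ (x , _) (y , _) (z , _) → distribʳ x y z)
          }
        }
      ; _·_ = λ s (x , x∈P) → s · x , ·-closed s x∈P
      ; isPreleftSemimodule = record
        { *ₗ-cong = ·-cong
        ; *ₗ-zeroˡ = λ (x , _) → ·-zeroˡ x
        ; *ₗ-distribʳ = λ (x , _) s t → ·-distribʳ x s t
        ; *ₗ-identityˡ = λ (x , _) → ·-identityˡ x
        ; *ₗ-assoc = λ s t (x , _) → ·-assoc s t x
        ; *ₗ-zeroʳ = ·-zeroʳ
        ; *ₗ-distribˡ = λ s (x , _) (y , _) → ·-distribˡ s x y
        }
      ; ·-*-assocˡ = λ s (x , _) (y , _) → ·-*-assocˡ s x y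
      ; ·-*-assocʳ = λ s (x , _) (y , _) → ·-*-assocʳ s x y
      }
      where open IsSubalgebra isSub

    rightIdealizer : Pred Carrier p → Pred Carrier (a ⊔ p)
    rightIdealizer C g = ∀ {h} → h ∈ C → h * g ∈ C

    rightIdealizer-isSubalgebra : {C : Pred Carrier p} → IsSubspace C → IsSubalgebra (rightIdealizer C)
    rightIdealizer-isSubalgebra C-sub = record
      { isSubspace = record
        { resp = λ g≈g′ g∈R h∈C → resp (*-congˡ g≈g′) (g∈R h∈C)
        ; 0-closed = λ _ → resp (sym (zeroʳ _)) 0-closed
        ; +-closed = λ g∈R g′∈R h∈C → resp (sym (distribˡ _ _ _)) (+-closed (g∈R h∈C) (g′∈R h∈C))
        ; ·-closed = λ s g∈R h∈C → resp (sym (·-*-assocʳ s _ _)) (·-closed s (g∈R h∈C))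
        }
      ; 1-closed = λ h∈C → resp (sym (*-identityʳ _)) h∈C
      ; *-closed = λ g∈R g′∈R h∈C → resp (*-assoc _ _ _) (g′∈R (g∈R h∈C))
      }
      where open IsSubspace C-sub

-- A field with exactly N elements (up to the setoid equality).
record FiniteField (c ℓ : Level) (N : ℕ) : Set (lsuc (c ⊔ ℓ)) where
  field
    commutativeRing : CommutativeRing c ℓ
  open CommutativeRing commutativeRing public
  field
    1≉0         : 1# ≉ 0#
    *-inverse   : ∀ x → x ≉ 0# → ∃[ y ] x * y ≈ 1#
    enumeration : Inverse (≡.setoid (Fin N)) setoid

module FiniteFieldProperties {c ℓ N} (𝔽 : FiniteField c ℓ N) where
  open FiniteField 𝔽 hiding (zero)
  open Exponentiation commutativeSemiring
  open Multiplication semiring using (×-congˡ; ×1-homo-*) renaming (_×_ to _ᴺ×_)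
  open RingProperties (CommutativeRing.ring commutativeRing) using (+-cancelˡ)
  open SetoidReasoning setoid
  private
    module ∑ = SemiringSum semiring
    module ∏ = MonoidSum *-commutativeMonoid
    module E = Inverse enumeration

    e : Fin N → Carrier
    e = E.to

    d : Carrier → Fin N
    d = E.from

    ed : ∀ x → e (d x) ≈ x
    ed x = E.inverseˡ ≡.refl

    de : ∀ i → d (e i) ≡ i
    de i = E.inverseʳ refl

  infix 4 _≟_
  abstract
    _≟_ : ∀ x y → Dec (x ≈ y)
    x ≟ y = Dec.map′ (λ eq → trans (sym (ed x)) (trans (reflexive (≡.cong e eq)) (ed y))) E.from-cong
                     (d x Fin.≟ d y)

  xy≈0⇒y≈0 : ∀ {x y} → x ≉ 0# → x * y ≈ 0# → y ≈ 0#
  xy≈0⇒y≈0 {x} {y} x≉0 xy≈0 = begin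
    y              ≈⟨ *-identityˡ y ⟨
    1# * y         ≈⟨ *-congʳ (trans (*-comm z x) xz≈1) ⟨
    (z * x) * y    ≈⟨ *-assoc z x y ⟩
    z * (x * y)    ≈⟨ *-congˡ xy≈0 ⟩
    z * 0#         ≈⟨ zeroʳ z ⟩
    0#             ∎
    where
    z = proj₁ (*-inverse x x≉0)
    xz≈1 = proj₂ (*-inverse x x≉0)

  *-cancelʳ : ∀ {x y z} → z ≉ 0# → x * z ≈ y * z → x ≈ y
  *-cancelʳ {x} {y} {z} z≉0 eq = begin
    x              ≈⟨ cancel x ⟨
    (x * z) * w    ≈⟨ *-congʳ eq ⟩
    (y * z) * w    ≈⟨ cancel y ⟩
    y              ∎
    where
    w = proj₁ (*-inverse z z≉0)
    cancel : ∀ u → (u * z) * w ≈ u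
    cancel u = trans (*-assoc u z w) (trans (*-congˡ (proj₂ (*-inverse z z≉0))) (*-identityʳ u))

  x^m≈0⇒x≈0 : ∀ x m → x ^ m ≈ 0# → x ≈ 0#
  x^m≈0⇒x≈0 x zero    1≈0 = ⊥-elim (1≉0 1≈0)
  x^m≈0⇒x≈0 x (suc m) eq with x ≟ 0#
  ... | yes x≈0 = x≈0
  ... | no  x≉0 = x^m≈0⇒x≈0 x m (xy≈0⇒y≈0 x≉0 eq)

  private
    shuffle : (σ τ : Carrier → Carrier) → σ Preserves _≈_ ⟶ _≈_ → τ Preserves _≈_ ⟶ _≈_ →
              (∀ x → σ (τ x) ≈ x) → (∀ x → τ (σ x) ≈ x) → Permutation′ N
    shuffle σ τ σ-cong τ-cong στ τσ = permutation (λ i → d (σ (e i))) (λ i → d (τ (e i)))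
      (λ i → ≡.trans (E.from-cong (trans (σ-cong (ed _)) (στ (e i)))) (de i))
      (λ i → ≡.trans (E.from-cong (trans (τ-cong (ed _)) (τσ (e i)))) (de i))

  N×1≈0 : N ᴺ× 1# ≈ 0#
  N×1≈0 = +-cancelˡ (∑.sum e) (N ᴺ× 1#) 0# (begin
    ∑.sum e + N ᴺ× 1#                     ≈⟨ +-congˡ (∑.sum-replicate N) ⟨
    ∑.sum e + ∑.sum (replicate N 1#)      ≈⟨ ∑.∑-distrib-+ e (λ _ → 1#) ⟨
    ∑.sum (λ i → e i + 1#)                ≈⟨ ∑.sum-cong-≋ (λ i → ed (e i + 1#)) ⟨
    ∑.sum (λ i → e (d (e i + 1#)))        ≈⟨ ∑.sum-permute e π ⟨
    ∑.sum e                               ≈⟨ +-identityʳ _ ⟨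
    ∑.sum e + 0#                          ∎)
    where
    undo : ∀ x y z → y + z ≈ 0# → (x + y) + z ≈ x
    undo x y z eq = trans (+-assoc x y z) (trans (+-congˡ eq) (+-identityʳ x))
    π = shuffle (_+ 1#) (_+ - 1#) +-congʳ +-congʳ
          (λ x → undo x _ _ (-‿inverseˡ 1#)) (λ x → undo x _ _ (-‿inverseʳ 1#))

  p×1≈0 : ∀ p m → N ≡ p ℕ.^ m → p ᴺ× 1# ≈ 0#
  p×1≈0 p m eq = x^m≈0⇒x≈0 (p ᴺ× 1#) m
    (trans (sym (×1-homo-^ m)) (trans (×-congˡ (≡.sym eq)) N×1≈0))
    where
    ×1-homo-^ : ∀ m → (p ℕ.^ m) ᴺ× 1# ≈ (p ᴺ× 1#) ^ m
    ×1-homo-^ zero    = +-identityʳ 1#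
    ×1-homo-^ (suc m) = trans (×1-homo-* p (p ℕ.^ m)) (*-congˡ (×1-homo-^ m))

  private
    g : Carrier → Carrier
    g x = if does (x ≟ 0#) then 1# else x

    g≉0 : ∀ x → g x ≉ 0#
    g≉0 x with x ≟ 0#
    ... | yes _   = 1≉0
    ... | no  x≉0 = x≉0

    g-cong : g Preserves _≈_ ⟶ _≈_
    g-cong {x} {y} x≈y with x ≟ 0# | y ≟ 0#
    ... | yes _   | yes _   = refl
    ... | yes x≈0 | no  y≉0 = ⊥-elim (y≉0 (trans (sym x≈y) x≈0))
    ... | no  x≉0 | yes y≈0 = ⊥-elim (x≉0 (trans x≈y y≈0))
    ... | no  _   | no  _   = x≈y

    ∏≉0 : ∀ {m} (t : Vector Carrier m) → (∀ i → t i ≉ 0#) → ∏.sum t ≉ 0#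
    ∏≉0 {zero}  t t≉0 = 1≉0
    ∏≉0 {suc m} t t≉0 eq = ∏≉0 (λ i → t (suc i)) (λ i → t≉0 (suc i)) (xy≈0⇒y≈0 (t≉0 zero) eq)

    ∏-except : ∀ {m} x (i₀ : Fin m) (t : Vector Carrier m) → t i₀ ≈ 1# →
               (∀ i → i ≢ i₀ → t i ≈ x) → x * ∏.sum t ≈ x ^ m
    ∏-except {suc m} x i₀ t t₀ t≈ = *-congˡ (begin
      ∏.sum t                              ≈⟨ ∏.sum-remove {i = i₀} t ⟩
      t i₀ * ∏.sum (removeAt t i₀)         ≈⟨ *-cong t₀ (∏.sum-cong-≋ (λ j → t≈ (punchIn i₀ j) (Fin.punchInᵢ≢i i₀ j))) ⟩
      1# * ∏.sum (replicate m x)           ≈⟨ *-identityˡ _ ⟩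
      ∏.sum (replicate m x)                ≈⟨ ∏.sum-replicate m ⟩
      x ^ m                                ∎)

    0^m≈0 : ∀ {m} → Fin m → 0# ^ m ≈ 0#
    0^m≈0 {suc m} _ = zeroˡ _

  x^N≈x : ∀ x → x ^ N ≈ x
  x^N≈x x with x ≟ 0#
  ... | yes x≈0 = trans (^-congˡ N x≈0) (trans (0^m≈0 (d 0#)) (sym x≈0))
  ... | no  x≉0 = begin
    x ^ N              ≈⟨ ∏-except x (d 0#) (λ i → h (e i)) h₀ h≈x ⟨
    x * ∏.sum (λ i → h (e i))   ≈⟨ *-congˡ ∏h≈1 ⟩
    x * 1#             ≈⟨ *-identityʳ x ⟩
    x                  ∎
    where
    x⁻¹ = proj₁ (*-inverse x x≉0)
    xx⁻¹ = proj₂ (*-inverse x x≉0)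

    h : Carrier → Carrier
    h y = if does (y ≟ 0#) then 1# else x

    h₀ : h (e (d 0#)) ≈ 1#
    h₀ with e (d 0#) ≟ 0#
    ... | yes _  = refl
    ... | no  ≉0 = ⊥-elim (≉0 (ed 0#))

    h≈x : ∀ i → i ≢ d 0# → h (e i) ≈ x
    h≈x i i≢ with e i ≟ 0#
    ... | yes eᵢ≈0 = ⊥-elim (i≢ (≡.trans (≡.sym (de i)) (E.from-cong eᵢ≈0)))
    ... | no  _    = refl

    hg : ∀ y → h y * g y ≈ g (x * y)
    hg y with y ≟ 0# | (x * y) ≟ 0#
    ... | yes _   | yes _    = *-identityˡ 1#
    ... | yes y≈0 | no  xy≉0 = ⊥-elim (xy≉0 (trans (*-congˡ y≈0) (zeroʳ x)))
    ... | no  y≉0 | yes xy≈0 = ⊥-elim (y≉0 (xy≈0⇒y≈0 x≉0 xy≈0))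
    ... | no  _   | no  _    = refl

    undo : ∀ u v y → u * v ≈ 1# → u * (v * y) ≈ y
    undo u v y uv≈1 = trans (sym (*-assoc u v y)) (trans (*-congʳ uv≈1) (*-identityˡ y))

    π = shuffle (x *_) (x⁻¹ *_) *-congˡ *-congˡ
          (λ y → undo x x⁻¹ y xx⁻¹) (λ y → undo x⁻¹ x y (trans (*-comm x⁻¹ x) xx⁻¹))

    ∏g = ∏.sum (λ i → g (e i))

    ∏h≈1 : ∏.sum (λ i → h (e i)) ≈ 1#
    ∏h≈1 = *-cancelʳ (∏≉0 (λ i → g (e i)) (λ i → g≉0 (e i))) (begin
      ∏.sum (λ i → h (e i)) * ∏g             ≈⟨ ∏.∑-distrib-+ (λ i → h (e i)) (λ i → g (e i)) ⟨
      ∏.sum (λ i → h (e i) * g (e i))        ≈⟨ ∏.sum-cong-≋ (λ i → trans (hg (e i)) (g-cong (sym (ed (x * e i))))) ⟩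
      ∏.sum (λ i → g (e (d (x * e i))))      ≈⟨ ∏.sum-permute (λ i → g (e i)) π ⟨
      ∏g                                     ≈⟨ *-identityˡ ∏g ⟨
      1# * ∏g                                ∎)

absorption : ∀ n k → suc k ℕ.* (suc n C suc k) ≡ suc n ℕ.* (n C k)
absorption zero zero    = ≡.refl
absorption zero (suc k) = begin
  suc (suc k) ℕ.* (1 C suc (suc k))  ≡⟨ ≡.cong (suc (suc k) ℕ.*_) (k>n⇒nCk≡0 {1} {suc (suc k)} (ℕ.s≤s (ℕ.s≤s ℕ.z≤n))) ⟩
  suc (suc k) ℕ.* 0                  ≡⟨ ℕ.*-zeroʳ (suc (suc k)) ⟩
  0                                  ≡⟨ ≡.cong (1 ℕ.*_) (k>n⇒nCk≡0 {0} {suc k} (ℕ.s≤s ℕ.z≤n)) ⟨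
  1 ℕ.* (0 C suc k)                  ∎
  where open ≡.≡-Reasoning
absorption (suc n) zero = begin
  1 ℕ.* (suc (suc n) C 1)            ≡⟨ ≡.cong (1 ℕ.*_) (nC1≡n (suc (suc n))) ⟩
  1 ℕ.* suc (suc n)                  ≡⟨ ℕ.*-comm 1 (suc (suc n)) ⟩
  suc (suc n) ℕ.* 1                  ∎
  where open ≡.≡-Reasoning
absorption (suc n) (suc j) = begin
  suc k ℕ.* (suc (suc n) C suc k)                  ≡⟨ ≡.cong (suc k ℕ.*_) (nCk+nC[k+1]≡[n+1]C[k+1] (suc n) k) ⟨
  suc k ℕ.* (c ℕ.+ (suc n C suc k))                ≡⟨ ℕ.*-distribˡ-+ (suc k) c (suc n C suc k) ⟩
  suc k ℕ.* c ℕ.+ suc k ℕ.* (suc n C suc k)        ≡⟨ ≡.cong₂ ℕ._+_ (≡.cong (c ℕ.+_) (absorption n j)) (absorption n k) ⟩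
  (c ℕ.+ suc n ℕ.* (n C j)) ℕ.+ suc n ℕ.* (n C k)  ≡⟨ ℕ.+-assoc c _ _ ⟩
  c ℕ.+ (suc n ℕ.* (n C j) ℕ.+ suc n ℕ.* (n C k))  ≡⟨ ≡.cong (c ℕ.+_) (ℕ.*-distribˡ-+ (suc n) (n C j) (n C k)) ⟨
  c ℕ.+ suc n ℕ.* ((n C j) ℕ.+ (n C k))            ≡⟨ ≡.cong (λ z → c ℕ.+ suc n ℕ.* z) (nCk+nC[k+1]≡[n+1]C[k+1] n j) ⟩
  suc (suc n) ℕ.* c                                ∎
  where
  open ≡.≡-Reasoning
  k = suc j
  c = suc n C k

prime∣C : ∀ {n k} → Prime (suc n) → k ℕ.< n → suc n ∣ (suc n C suc k)
prime∣C {n} {k} pr k<n with euclidsLemma (suc k) (suc n C suc k) pr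
    (divides (n C k) (≡.trans (absorption n k) (ℕ.*-comm (suc n) (n C k))))
... | inj₁ p∣k+1 = ⊥-elim (ℕ.<⇒≱ (ℕ.s≤s k<n) (∣⇒≤ p∣k+1))
... | inj₂ p∣C   = p∣C

module FreshmansDream {c ℓ} (R : CommutativeRing c ℓ) where
  open CommutativeRing R hiding (zero)
  open Exponentiation commutativeSemiring
  open Multiplication semiring using (×-congˡ; ×-congʳ; ×-assocˡ; ×-comm-*; ×-homo-1) renaming (_×_ to _ᴺ×_)
  open SemiringSum semiring using (sum; sum-cong-≋; sum-replicate-zero; sum-init-last)
  open SetoidReasoning setoid

  module _ {p} (p×1≈0 : p ᴺ× 1# ≈ 0#) where

    p×x≈0 : ∀ x → p ᴺ× x ≈ 0#
    p×x≈0 x = begin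
      p ᴺ× x           ≈⟨ ×-congʳ p (*-identityʳ x) ⟨
      p ᴺ× (x * 1#)    ≈⟨ ×-comm-* p x 1# ⟨
      x * (p ᴺ× 1#)    ≈⟨ *-congˡ p×1≈0 ⟩
      x * 0#           ≈⟨ zeroʳ x ⟩
      0#               ∎

    multiple≈0 : ∀ {m} → p ∣ m → ∀ x → m ᴺ× x ≈ 0#
    multiple≈0 (divides q ≡.refl) x = trans (×-congˡ (ℕ.*-comm q p))
      (trans (sym (×-assocˡ x p q)) (p×x≈0 (q ᴺ× x)))

  +-^-prime : ∀ {p} → Prime p → p ᴺ× 1# ≈ 0# → ∀ x y → (x + y) ^ p ≈ x ^ p + y ^ p
  +-^-prime {zero} pr = ⊥-elim (ℕ.≢-nonZero⁻¹ 0 {{prime⇒nonZero pr}} ≡.refl)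
  +-^-prime {suc m} pr p×1≈0 x y = begin
    (x + y) ^ suc m                                       ≈⟨ Binomial.theorem commutativeSemiring (suc m) x y ⟩
    term zero + sum (λ k → term (suc k))                  ≈⟨ +-cong term₀ (sum-init-last (λ k → term (suc k))) ⟩
    y ^ suc m + (sum (λ k → term (suc (inject₁ k))) + term (suc (fromℕ m)))
                                                          ≈⟨ +-congˡ (+-cong middle termₘ) ⟩
    y ^ suc m + (0# + x ^ suc m)                          ≈⟨ +-congˡ (+-identityˡ _) ⟩
    y ^ suc m + x ^ suc m                                 ≈⟨ +-comm _ _ ⟩
    x ^ suc m + y ^ suc m                                 ∎
    where
    term = Binomial.binomialTerm commutativeSemiring x y (suc m)

    term₀ : term zero ≈ y ^ suc m
    term₀ = trans (×-homo-1 _) (*-identityˡ _)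

    termₘ : term (suc (fromℕ m)) ≈ x ^ suc m
    termₘ rewrite Fin.toℕ-fromℕ m | nCn≡1 (suc m) | ℕ.n∸n≡0 m = trans (×-homo-1 _) (*-identityʳ _)

    middle : sum (λ k → term (suc (inject₁ k))) ≈ 0#
    middle = trans (sum-cong-≋ vanish) (sum-replicate-zero m)
      where
      vanish : ∀ k → term (suc (inject₁ k)) ≈ 0#
      vanish k = multiple≈0 p×1≈0
        (prime∣C pr (≡.subst (ℕ._< m) (≡.sym (Fin.toℕ-inject₁ k)) (Fin.toℕ<n k))) _

  +-^-prime^ : ∀ {p} → Prime p → p ᴺ× 1# ≈ 0# → ∀ m x y → (x + y) ^ (p ℕ.^ m) ≈ x ^ (p ℕ.^ m) + y ^ (p ℕ.^ m)
  +-^-prime^ pr p×1≈0 zero x y = trans (*-identityʳ _) (sym (+-cong (*-identityʳ x) (*-identityʳ y)))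
  +-^-prime^ {p} pr p×1≈0 (suc m) x y = begin
    (x + y) ^ (p ℕ.* p ℕ.^ m)                            ≈⟨ ^-assocʳ (x + y) p (p ℕ.^ m) ⟨
    ((x + y) ^ p) ^ (p ℕ.^ m)                            ≈⟨ ^-congˡ (p ℕ.^ m) (+-^-prime pr p×1≈0 x y) ⟩
    (x ^ p + y ^ p) ^ (p ℕ.^ m)                          ≈⟨ +-^-prime^ pr p×1≈0 m (x ^ p) (y ^ p) ⟩
    (x ^ p) ^ (p ℕ.^ m) + (y ^ p) ^ (p ℕ.^ m)            ≈⟨ +-cong (^-assocʳ x p (p ℕ.^ m)) (^-assocʳ y p (p ℕ.^ m)) ⟩
    x ^ (p ℕ.* p ℕ.^ m) + y ^ (p ℕ.* p ℕ.^ m)            ∎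

module Matrices {c ℓ} (K : CommutativeRing c ℓ) where
  open CommutativeRing K hiding (zero)
  open SemiringSum semiring
  open SetoidReasoning setoid

  infix 4 _≋_
  _≋_ : ∀ {m} → Vector Carrier m → Vector Carrier m → Set ℓ
  u ≋ v = ∀ i → u i ≈ v i

  -- a times the k-th standard basis vector
  single : ∀ {m} → Fin m → Carrier → Vector Carrier m
  single k a l = if does (k Fin.≟ l) then a else 0#

  single-cong : ∀ {m} (k l : Fin m) {x y} → x ≈ y → single k x l ≈ single k y l
  single-cong k l x≈y with does (k Fin.≟ l)
  ... | true  = x≈y
  ... | false = refl

  single-cong₂ : ∀ {m} {k k′ : Fin m} l {x y} → k ≡ k′ → x ≈ y → single k x l ≈ single k′ y l
  single-cong₂ {k = k} l ≡.refl = single-cong k l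

  single-+ : ∀ {m} (k l : Fin m) x y → single k (x + y) l ≈ single k x l + single k y l
  single-+ k l x y with does (k Fin.≟ l)
  ... | true  = refl
  ... | false = sym (+-identityˡ 0#)

  single-0 : ∀ {m} (k l : Fin m) → single k 0# l ≈ 0#
  single-0 k l with does (k Fin.≟ l)
  ... | true  = refl
  ... | false = refl

  *-single : ∀ {m} (k l : Fin m) x y → x * single k y l ≈ single k (x * y) l
  *-single k l x y with does (k Fin.≟ l)
  ... | true  = refl
  ... | false = zeroʳ x

  single-on : ∀ {m} (k : Fin m) x → single k x k ≈ x
  single-on k x with k Fin.≟ k
  ... | yes _   = refl
  ... | no  k≢k = ⊥-elim (k≢k ≡.refl)

  single-off : ∀ {m} (k l : Fin m) x → k ≢ l → single k x l ≈ 0#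
  single-off k l x k≢l with k Fin.≟ l
  ... | yes k≡l = ⊥-elim (k≢l k≡l)
  ... | no  _   = refl

  sum-only : ∀ {m} (k : Fin m) (t : Vector Carrier m) → (∀ l → k ≢ l → t l ≈ 0#) → sum t ≈ t k
  sum-only {suc m} k t t≈0 = begin
    sum t                          ≈⟨ sum-remove {i = k} t ⟩
    t k + sum (removeAt t k)       ≈⟨ +-congˡ (sum-cong-≋ (λ j → t≈0 (punchIn k j) (λ eq → Fin.punchInᵢ≢i k j (≡.sym eq)))) ⟩
    t k + sum (replicate m 0#)     ≈⟨ +-congˡ (sum-replicate-zero m) ⟩
    t k + 0#                       ≈⟨ +-identityʳ _ ⟩
    t k                            ∎

  record IsAdditive (F : Carrier → Carrier) : Set (c ⊔ ℓ) where
    field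
      F-cong : F Preserves _≈_ ⟶ _≈_
      F-+    : ∀ x y → F (x + y) ≈ F x + F y
      F-0    : F 0# ≈ 0#

    F-sum : ∀ {m} (t : Vector Carrier m) → F (sum t) ≈ sum (λ i → F (t i))
    F-sum {zero}  t = F-0
    F-sum {suc m} t = trans (F-+ _ _) (+-congˡ (F-sum (λ i → t (suc i))))

  open IsAdditive public

  sum-isAdditive : ∀ {m} {F : Fin m → Carrier → Carrier} → (∀ i → IsAdditive (F i)) →
                   IsAdditive (λ x → sum (λ i → F i x))
  sum-isAdditive {m} F-add = record
    { F-cong = λ x≈y → sum-cong-≋ (λ i → F-cong (F-add i) x≈y)
    ; F-+ = λ x y → trans (sum-cong-≋ (λ i → F-+ (F-add i) x y)) (∑-distrib-+ {m} _ _)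
    ; F-0 = trans (sum-cong-≋ (λ i → F-0 (F-add i))) (sum-replicate-zero m)
    }

  sum-single : ∀ {m} {F : Fin m → Carrier → Carrier} → (∀ i → IsAdditive (F i)) →
               ∀ k x → sum (λ l → F l (single k x l)) ≈ F k x
  sum-single {F = F} F-add k x = trans
    (sum-only k _ (λ l k≢l → trans (F-cong (F-add l) (single-off k l x k≢l)) (F-0 (F-add l))))
    (F-cong (F-add k) (single-on k x))

  sum-of-singles : ∀ {m} (t : Vector Carrier m) l → sum (λ k → single k (t k) l) ≈ t l
  sum-of-singles t l = trans
    (sum-only l _ (λ k l≢k → single-off k l (t k) (λ eq → l≢k (≡.sym eq))))
    (single-on l (t l))

  *x-isAdditive : ∀ x → IsAdditive (_* x)
  *x-isAdditive x = record { F-cong = *-congʳ ; F-+ = λ y z → distribʳ x y z ; F-0 = zeroˡ x }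

  Matrix : ℕ → Set c
  Matrix m = Fin m → Fin m → Carrier

  infixl 7 _*ᴹ_ _*ᵥ_
  _*ᴹ_ : ∀ {m} → Matrix m → Matrix m → Matrix m
  _*ᴹ_ {m} A B i l = ∑[ j < m ] (A i j * B j l)

  _*ᵥ_ : ∀ {m} → Matrix m → Vector Carrier m → Vector Carrier m
  _*ᵥ_ {m} A v i = ∑[ j < m ] (A i j * v j)

  1ᴹ : ∀ {m} → Matrix m
  1ᴹ i = single i 1#

  *ᵥ-cong : ∀ {m} {A B : Matrix m} {u v} → (∀ i → A i ≋ B i) → u ≋ v → A *ᵥ u ≋ B *ᵥ v
  *ᵥ-cong A≈B u≈v i = sum-cong-≋ (λ j → *-cong (A≈B i j) (u≈v j))

  *ᵥ-assoc : ∀ {m} (A B : Matrix m) v → (A *ᴹ B) *ᵥ v ≋ A *ᵥ (B *ᵥ v)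
  *ᵥ-assoc {m} A B v i = begin
    ∑[ j < m ] ((∑[ k < m ] (A i k * B k j)) * v j)   ≈⟨ sum-cong-≋ {m} (λ j → *-distribʳ-sum {m} (v j) _) ⟩
    ∑[ j < m ] ∑[ k < m ] (A i k * B k j * v j)       ≈⟨ ∑-comm {m} {m} _ ⟩
    ∑[ k < m ] ∑[ j < m ] (A i k * B k j * v j)       ≈⟨ sum-cong-≋ {m} (λ k → sum-cong-≋ {m} (λ j → *-assoc _ _ _)) ⟩
    ∑[ k < m ] ∑[ j < m ] (A i k * (B k j * v j))     ≈⟨ sum-cong-≋ {m} (λ k → *-distribˡ-sum {m} (A i k) _) ⟨
    ∑[ k < m ] (A i k * ∑[ j < m ] (B k j * v j))     ∎

  1ᴹ*ᵥ : ∀ {m} (v : Vector Carrier m) → 1ᴹ *ᵥ v ≋ v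
  1ᴹ*ᵥ v i = trans (sum-single (λ j → *x-isAdditive (v j)) i 1#) (*-identityˡ (v i))

  *ᵥ-distribʳ : ∀ {m} (A B : Matrix m) v → (λ i j → A i j + B i j) *ᵥ v ≋ (λ i → (A *ᵥ v) i + (B *ᵥ v) i)
  *ᵥ-distribʳ {m} A B v i = trans (sum-cong-≋ (λ j → distribʳ (v j) (A i j) (B i j))) (∑-distrib-+ {m} _ _)

  *ᵥ-distribˡ : ∀ {m} (A : Matrix m) u v → A *ᵥ (λ i → u i + v i) ≋ (λ i → (A *ᵥ u) i + (A *ᵥ v) i)
  *ᵥ-distribˡ {m} A u v i = trans (sum-cong-≋ (λ j → distribˡ (A i j) (u j) (v j))) (∑-distrib-+ {m} _ _)

  *ᵥ-scaleˡ : ∀ {m} x (A : Matrix m) v → (λ i j → x * A i j) *ᵥ v ≋ (λ i → x * (A *ᵥ v) i)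
  *ᵥ-scaleˡ {m} x A v i = trans (sum-cong-≋ {m} (λ j → *-assoc x (A i j) (v j))) (sym (*-distribˡ-sum {m} x _))

  *ᵥ-scaleʳ : ∀ {m} x (A : Matrix m) v → A *ᵥ (λ i → x * v i) ≋ (λ i → x * (A *ᵥ v) i)
  *ᵥ-scaleʳ {m} x A v i = trans (sum-cong-≋ {m} (λ j → swap (A i j) x (v j))) (sym (*-distribˡ-sum {m} x _))
    where
    swap : ∀ a b d → a * (b * d) ≈ b * (a * d)
    swap a b d = trans (sym (*-assoc a b d)) (trans (*-congʳ (*-comm a b)) (*-assoc b a d))

  matrix-isRing : ∀ m → IsRing (λ (A B : Matrix m) → ∀ i → A i ≋ B i) (λ A B i j → A i j + B i j)
                    _*ᴹ_ (λ A i j → - A i j) (λ _ _ → 0#) 1ᴹ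
  matrix-isRing m = record
    { +-isAbelianGroup = Pointwise.isAbelianGroup (Fin m) (Pointwise.isAbelianGroup (Fin m) +-isAbelianGroup)
    ; *-cong = λ A≈A′ B≈B′ i l → *ᵥ-cong A≈A′ (λ j → B≈B′ j l) i
    ; *-assoc = λ A B C i l → *ᵥ-assoc A B (λ j → C j l) i
    ; *-identity = (λ A i l → 1ᴹ*ᵥ (λ j → A j l) i)
                 , (λ A i l → trans (sum-cong-≋ (λ j → trans (*-single j l (A i j) 1#) (single-cong j l (*-identityʳ (A i j)))))
                                    (sum-of-singles (A i) l))
    ; distrib = (λ A B C i l → *ᵥ-distribˡ A (λ j → B j l) (λ j → C j l) i)
              , (λ C A B i l → *ᵥ-distribʳ A B (λ j → C j l) i)
    }

-- F_{q^n} as an extension of F_q: a ring homomorphism between fields is injective.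
record FiniteFieldExtension (c ℓ c′ ℓ′ : Level) (q n : ℕ) : Set (lsuc (c ⊔ ℓ ⊔ c′ ⊔ ℓ′)) where
  field
    𝔽q  : FiniteField c ℓ q
    𝔽qⁿ : FiniteField c′ ℓ′ (q ℕ.^ n)
  private
    module F = FiniteField 𝔽q
    module K = FiniteField 𝔽qⁿ
  field
    ι                    : F.Carrier → K.Carrier
    ι-isRingHomomorphism : IsRingHomomorphism F.rawRing K.rawRing ι

module LinearizedPolynomials {c ℓ c′ ℓ′ : Level} {q : ℕ} (q-primePower : IsPrimePower q)
         (n : ℕ) .{{n≢0 : NonZero n}} (𝔼 : FiniteFieldExtension c ℓ c′ ℓ′ q n) where
  open FiniteFieldExtension 𝔼
  private
    module F = FiniteField 𝔽q
  open FiniteField 𝔽qⁿ hiding (zero) renaming (Carrier to K)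
  open IsRingHomomorphism ι-isRingHomomorphism
    renaming (⟦⟧-cong to ι-cong; +-homo to ι-+; *-homo to ι-*; 0#-homo to ι-0; 1#-homo to ι-1) using ()
  open Exponentiation commutativeSemiring
  open SemiringSum semiring
  open Matrices commutativeRing
  open SetoidReasoning setoid

  -- Σᵢ aᵢ x^(q^i), 0 ≤ i < n, is represented by its coefficients.
  ℒ : Set c′
  ℒ = Vector K n

  eval : ℒ → K → K
  eval f y = ∑[ i < n ] (f i * y ^ (q ℕ.^ toℕ i))

  X : ℒ
  X = single (0 mod n) 1#

  -- Exponents of q add modulo n because x^(q^n) = x.
  _⊕_ : Fin n → Fin n → Fin n
  i ⊕ j = (toℕ i ℕ.+ toℕ j) mod n

  -- a x^(q^i) ∘ b x^(q^j) = a b^(q^i) x^(q^(i+j)), extended biadditively.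
  infixl 7 _∘_
  _∘_ : ℒ → ℒ → ℒ
  (f ∘ g) l = ∑[ i < n ] ∑[ j < n ] single (i ⊕ j) (f i * g j ^ (q ℕ.^ toℕ i)) l

  infixl 6 _+ᴸ_
  _+ᴸ_ : ℒ → ℒ → ℒ
  (f +ᴸ g) i = f i + g i

  infixr 7 _*ₗ_
  _*ₗ_ : K → ℒ → ℒ
  (a *ₗ f) i = a * f i

  Fr : ℕ → K → K
  Fr i y = y ^ (q ℕ.^ i)

  Fr-cong : ∀ i {x y} → x ≈ y → Fr i x ≈ Fr i y
  Fr-cong i = ^-congˡ (q ℕ.^ i)

  Fr-* : ∀ i x y → Fr i (x * y) ≈ Fr i x * Fr i y
  Fr-* i x y = ^-distrib-* x y (q ℕ.^ i)

  Fr-1 : ∀ i → Fr i 1# ≈ 1#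
  Fr-1 i = 1^ (q ℕ.^ i)
    where
    1^ : ∀ m → 1# ^ m ≈ 1#
    1^ zero    = refl
    1^ (suc m) = trans (*-identityˡ _) (1^ m)

  Fr-+ : ∀ i x y → Fr i (x + y) ≈ Fr i x + Fr i y
  Fr-+ i x y = additive q-primePower
    where
    additive : IsPrimePower q → Fr i (x + y) ≈ Fr i x + Fr i y
    additive (p , k , p-prime , _ , q≡pᵏ) = begin
      (x + y) ^ (q ℕ.^ i)                                ≡⟨ ≡.cong ((x + y) ^_) (power i) ⟩
      (x + y) ^ (p ℕ.^ (k ℕ.* i))                        ≈⟨ FreshmansDream.+-^-prime^ commutativeRing p-prime
                                                              (FiniteFieldProperties.p×1≈0 𝔽qⁿ p (k ℕ.* n) (power n))
                                                              (k ℕ.* i) x y ⟩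
      x ^ (p ℕ.^ (k ℕ.* i)) + y ^ (p ℕ.^ (k ℕ.* i))      ≡⟨ ≡.cong (λ m → x ^ m + y ^ m) (power i) ⟨
      x ^ (q ℕ.^ i) + y ^ (q ℕ.^ i)                      ∎
      where
      power : ∀ m → q ℕ.^ m ≡ p ℕ.^ (k ℕ.* m)
      power m = ≡.trans (≡.cong (ℕ._^ m) q≡pᵏ) (ℕ.^-*-assoc p k m)

  Fr-0 : ∀ i → Fr i 0# ≈ 0#
  Fr-0 i = RingProperties.+-cancelˡ (FiniteField.ring 𝔽qⁿ) (Fr i 0#) (Fr i 0#) 0# (begin
    Fr i 0# + Fr i 0#    ≈⟨ Fr-+ i 0# 0# ⟨
    Fr i (0# + 0#)       ≈⟨ Fr-cong i (+-identityˡ 0#) ⟩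
    Fr i 0#              ≈⟨ +-identityʳ _ ⟨
    Fr i 0# + 0#         ∎)

  Fr-isAdditive : ∀ i → IsAdditive (Fr i)
  Fr-isAdditive i = record { F-cong = Fr-cong i ; F-+ = Fr-+ i ; F-0 = Fr-0 i }

  Fr-Fr : ∀ i j x → Fr i (Fr j x) ≈ Fr (i ℕ.+ j) x
  Fr-Fr i j x = trans (^-assocʳ x (q ℕ.^ j) (q ℕ.^ i))
    (^-congʳ x (≡.trans (ℕ.*-comm (q ℕ.^ j) (q ℕ.^ i)) (≡.sym (ℕ.^-distribˡ-+-* q i j))))

  Fr-multiple : ∀ m x → Fr (m ℕ.* n) x ≈ x
  Fr-multiple zero    x = *-identityʳ x
  Fr-multiple (suc m) x = begin
    Fr (n ℕ.+ m ℕ.* n) x      ≈⟨ Fr-Fr n (m ℕ.* n) x ⟨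
    Fr n (Fr (m ℕ.* n) x)     ≈⟨ FiniteFieldProperties.x^N≈x 𝔽qⁿ _ ⟩
    Fr (m ℕ.* n) x            ≈⟨ Fr-multiple m x ⟩
    x                         ∎

  toℕ-mod : ∀ m → toℕ (m mod n) ≡ m % n
  toℕ-mod m = Fin.toℕ-fromℕ< (m%n<n m n)

  Fr-mod : ∀ m x → Fr (toℕ (m mod n)) x ≈ Fr m x
  Fr-mod m x = begin
    Fr (toℕ (m mod n)) x                         ≡⟨ ≡.cong (λ i → Fr i x) (toℕ-mod m) ⟩
    Fr (m % n) x                                 ≈⟨ Fr-cong (m % n) (Fr-multiple (m / n) x) ⟨
    Fr (m % n) (Fr ((m / n) ℕ.* n) x)            ≈⟨ Fr-Fr (m % n) ((m / n) ℕ.* n) x ⟩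
    Fr (m % n ℕ.+ (m / n) ℕ.* n) x               ≡⟨ ≡.cong (λ i → Fr i x) (m≡m%n+[m/n]*n m n) ⟨
    Fr m x                                       ∎

  Fr-ι : ∀ i s → Fr i (ι s) ≈ ι s
  Fr-ι zero    s = *-identityʳ (ι s)
  Fr-ι (suc i) s = begin
    ι s ^ (q ℕ.* q ℕ.^ i)     ≈⟨ ^-assocʳ (ι s) q (q ℕ.^ i) ⟨
    (ι s ^ q) ^ (q ℕ.^ i)     ≈⟨ Fr-cong i (trans (ι-^ q) (ι-cong (FiniteFieldProperties.x^N≈x 𝔽q s))) ⟩
    ι s ^ (q ℕ.^ i)           ≈⟨ Fr-ι i s ⟩
    ι s                       ∎
    where
    open Exponentiation F.commutativeSemiring using () renaming (_^_ to _^F_)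
    ι-^ : ∀ m → ι s ^ m ≈ ι (s ^F m)
    ι-^ zero    = sym ι-1
    ι-^ (suc m) = trans (*-congˡ (ι-^ m)) (sym (ι-* s (s ^F m)))

  toℕ-injective-mod : ∀ {a b} → a % n ≡ b % n → a mod n ≡ b mod n
  toℕ-injective-mod {a} {b} eq = Fin.toℕ-injective (≡.trans (toℕ-mod a) (≡.trans eq (≡.sym (toℕ-mod b))))

  mod-toℕ : ∀ i → toℕ i mod n ≡ i
  mod-toℕ i = Fin.toℕ-injective (≡.trans (toℕ-mod (toℕ i)) (m<n⇒m%n≡m (Fin.toℕ<n i)))

  %-absorbˡ : ∀ a b → (a % n ℕ.+ b) % n ≡ (a ℕ.+ b) % n
  %-absorbˡ a b = ≡.trans (%-distribˡ-+ (a % n) b n)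
    (≡.trans (≡.cong (λ z → (z ℕ.+ b % n) % n) (m%n%n≡m%n a n)) (≡.sym (%-distribˡ-+ a b n)))

  ⊕-comm : ∀ i j → i ⊕ j ≡ j ⊕ i
  ⊕-comm i j = ≡.cong (_mod n) (ℕ.+-comm (toℕ i) (toℕ j))

  mod-⊕ : ∀ a j → (a mod n) ⊕ j ≡ (a ℕ.+ toℕ j) mod n
  mod-⊕ a j = toℕ-injective-mod (≡.trans (≡.cong (λ z → (z ℕ.+ toℕ j) % n) (toℕ-mod a)) (%-absorbˡ a (toℕ j)))

  ⊕-assoc : ∀ i j k → (i ⊕ j) ⊕ k ≡ i ⊕ (j ⊕ k)
  ⊕-assoc i j k = ≡.trans (mod-⊕ (toℕ i ℕ.+ toℕ j) k) (≡.trans (≡.cong (_mod n) shift)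
    (≡.trans (≡.sym (mod-⊕ (toℕ j ℕ.+ toℕ k) i)) (⊕-comm (j ⊕ k) i)))
    where
    shift : toℕ i ℕ.+ toℕ j ℕ.+ toℕ k ≡ toℕ j ℕ.+ toℕ k ℕ.+ toℕ i
    shift = ≡.trans (ℕ.+-assoc (toℕ i) (toℕ j) (toℕ k)) (ℕ.+-comm (toℕ i) _)

  ⊕-identityˡ : ∀ i → (0 mod n) ⊕ i ≡ i
  ⊕-identityˡ i = ≡.trans (mod-⊕ 0 i) (mod-toℕ i)

  single-isAdditive : ∀ {m} (k l : Fin m) {F : K → K} → IsAdditive F → IsAdditive (λ x → single k (F x) l)
  single-isAdditive k l F-add = record
    { F-cong = λ x≈y → single-cong k l (F-cong F-add x≈y)
    ; F-+ = λ x y → trans (single-cong k l (F-+ F-add x y)) (single-+ k l _ _)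
    ; F-0 = trans (single-cong k l (F-0 F-add)) (single-0 k l)
    }

  *Fr-isAdditive : ∀ x i → IsAdditive (λ y → x * Fr i y)
  *Fr-isAdditive x i = record
    { F-cong = λ y≈z → *-congˡ (Fr-cong i y≈z)
    ; F-+ = λ y z → trans (*-congˡ (Fr-+ i y z)) (distribˡ x _ _)
    ; F-0 = trans (*-congˡ (Fr-0 i)) (zeroʳ x)
    }

  sum-∘ : {F : Fin n → K → K} → (∀ l → IsAdditive (F l)) → ∀ f g →
          ∑[ l < n ] F l ((f ∘ g) l) ≈ ∑[ i < n ] ∑[ j < n ] F (i ⊕ j) (f i * Fr (toℕ i) (g j))
  sum-∘ {F} F-add f g = begin
    ∑[ l < n ] F l (∑[ i < n ] ∑[ j < n ] t i j l)       ≈⟨ sum-cong-≋ {n} (λ l → trans (F-sum (F-add l) {n} (λ i → sum (λ j → t i j l)))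
                                                             (sum-cong-≋ {n} (λ i → F-sum (F-add l) {n} (λ j → t i j l)))) ⟩
    ∑[ l < n ] ∑[ i < n ] ∑[ j < n ] F l (t i j l)       ≈⟨ ∑-comm {n} {n} _ ⟩
    ∑[ i < n ] ∑[ l < n ] ∑[ j < n ] F l (t i j l)       ≈⟨ sum-cong-≋ {n} (λ i → ∑-comm {n} {n} (λ l j → F l (t i j l))) ⟩
    ∑[ i < n ] ∑[ j < n ] ∑[ l < n ] F l (t i j l)       ≈⟨ sum-cong-≋ {n} (λ i → sum-cong-≋ {n} (λ j → sum-single F-add (i ⊕ j) _)) ⟩
    ∑[ i < n ] ∑[ j < n ] F (i ⊕ j) (f i * Fr (toℕ i) (g j)) ∎
    where
    t : Fin n → Fin n → Fin n → K
    t i j l = single (i ⊕ j) (f i * Fr (toℕ i) (g j)) l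

  ∘-cong : ∀ {f f′ g g′} → f ≋ f′ → g ≋ g′ → f ∘ g ≋ f′ ∘ g′
  ∘-cong f≈ g≈ l = sum-cong-≋ {n} λ i → sum-cong-≋ {n} λ j →
    single-cong (i ⊕ j) l (*-cong (f≈ i) (Fr-cong (toℕ i) (g≈ j)))

  Fr-⊕ : ∀ i j x y z → x * Fr (toℕ i) y * Fr (toℕ (i ⊕ j)) z ≈ x * Fr (toℕ i) (y * Fr (toℕ j) z)
  Fr-⊕ i j x y z = begin
    x * Fr (toℕ i) y * Fr (toℕ (i ⊕ j)) z            ≈⟨ *-assoc _ _ _ ⟩
    x * (Fr (toℕ i) y * Fr (toℕ (i ⊕ j)) z)          ≈⟨ *-congˡ (*-congˡ (Fr-mod (toℕ i ℕ.+ toℕ j) z)) ⟩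
    x * (Fr (toℕ i) y * Fr (toℕ i ℕ.+ toℕ j) z)      ≈⟨ *-congˡ (*-congˡ (Fr-Fr (toℕ i) (toℕ j) z)) ⟨
    x * (Fr (toℕ i) y * Fr (toℕ i) (Fr (toℕ j) z))   ≈⟨ *-congˡ (Fr-* (toℕ i) _ _) ⟨
    x * Fr (toℕ i) (y * Fr (toℕ j) z)                ∎

  eval-∘ : ∀ f g y → eval (f ∘ g) y ≈ eval f (eval g y)
  eval-∘ f g y = begin
    ∑[ l < n ] ((f ∘ g) l * Fr (toℕ l) y)
      ≈⟨ sum-∘ (λ l → *x-isAdditive (Fr (toℕ l) y)) f g ⟩
    ∑[ i < n ] ∑[ j < n ] (f i * Fr (toℕ i) (g j) * Fr (toℕ (i ⊕ j)) y)
      ≈⟨ sum-cong-≋ {n} (λ i → sum-cong-≋ {n} (λ j → Fr-⊕ i j (f i) (g j) y)) ⟩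
    ∑[ i < n ] ∑[ j < n ] (f i * Fr (toℕ i) (g j * Fr (toℕ j) y))
      ≈⟨ sum-cong-≋ {n} (λ i → F-sum (*Fr-isAdditive (f i) (toℕ i)) {n} (λ j → g j * Fr (toℕ j) y)) ⟨
    ∑[ i < n ] (f i * Fr (toℕ i) (eval g y)) ∎

  eval-X : ∀ y → eval X y ≈ y
  eval-X y = begin
    ∑[ i < n ] (X i * Fr (toℕ i) y)    ≈⟨ sum-single (λ i → *x-isAdditive (Fr (toℕ i) y)) (0 mod n) 1# ⟩
    1# * Fr (toℕ (0 mod n)) y          ≈⟨ *-identityˡ _ ⟩
    Fr (toℕ (0 mod n)) y               ≈⟨ Fr-mod 0 y ⟩
    y * 1#                             ≈⟨ *-identityʳ y ⟩
    y                                  ∎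

  ∘-assoc : ∀ f g h → (f ∘ g) ∘ h ≋ f ∘ (g ∘ h)
  ∘-assoc f g h l = begin
    ∑[ m < n ] ∑[ k < n ] single (m ⊕ k) ((f ∘ g) m * Fr (toℕ m) (h k)) l
      ≈⟨ sum-∘ (λ m → sum-isAdditive (λ k → single-isAdditive (m ⊕ k) l (*x-isAdditive (Fr (toℕ m) (h k))))) f g ⟩
    ∑[ i < n ] ∑[ j < n ] ∑[ k < n ] single ((i ⊕ j) ⊕ k) (f i * Fr (toℕ i) (g j) * Fr (toℕ (i ⊕ j)) (h k)) l
      ≈⟨ sum-cong-≋ {n} (λ i → sum-cong-≋ {n} (λ j → sum-cong-≋ {n} (λ k → match i j k))) ⟩
    ∑[ i < n ] ∑[ j < n ] ∑[ k < n ] single (i ⊕ (j ⊕ k)) (f i * Fr (toℕ i) (g j * Fr (toℕ j) (h k))) l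
      ≈⟨ sum-cong-≋ {n} (λ i → sum-∘ (λ m → single-isAdditive (i ⊕ m) l (*Fr-isAdditive (f i) (toℕ i))) g h) ⟨
    ∑[ i < n ] ∑[ m < n ] single (i ⊕ m) (f i * Fr (toℕ i) ((g ∘ h) m)) l ∎
    where
    match : ∀ i j k → single ((i ⊕ j) ⊕ k) (f i * Fr (toℕ i) (g j) * Fr (toℕ (i ⊕ j)) (h k)) l
                    ≈ single (i ⊕ (j ⊕ k)) (f i * Fr (toℕ i) (g j * Fr (toℕ j) (h k))) l
    match i j k = single-cong₂ l (⊕-assoc i j k) (Fr-⊕ i j (f i) (g j) (h k))

  ∘-identityˡ : ∀ f → X ∘ f ≋ f
  ∘-identityˡ f l = begin
    ∑[ i < n ] ∑[ j < n ] single (i ⊕ j) (X i * Fr (toℕ i) (f j)) l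
      ≈⟨ sum-single (λ i → sum-isAdditive (λ j → single-isAdditive (i ⊕ j) l (*x-isAdditive (Fr (toℕ i) (f j))))) (0 mod n) 1# ⟩
    ∑[ j < n ] single ((0 mod n) ⊕ j) (1# * Fr (toℕ (0 mod n)) (f j)) l
      ≈⟨ sum-cong-≋ {n} (λ j → single-cong₂ l (⊕-identityˡ j)
           (trans (*-identityˡ _) (trans (Fr-mod 0 (f j)) (*-identityʳ (f j))))) ⟩
    ∑[ j < n ] single j (f j) l
      ≈⟨ sum-of-singles f l ⟩
    f l ∎

  ∘-identityʳ : ∀ f → f ∘ X ≋ f
  ∘-identityʳ f l = begin
    ∑[ i < n ] ∑[ j < n ] single (i ⊕ j) (f i * Fr (toℕ i) (X j)) l
      ≈⟨ sum-cong-≋ {n} (λ i → sum-single (λ j → single-isAdditive (i ⊕ j) l (*Fr-isAdditive (f i) (toℕ i))) (0 mod n) 1#) ⟩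
    ∑[ i < n ] single (i ⊕ (0 mod n)) (f i * Fr (toℕ i) 1#) l
      ≈⟨ sum-cong-≋ {n} (λ i → single-cong₂ l (≡.trans (⊕-comm i (0 mod n)) (⊕-identityˡ i))
           (trans (*-congˡ (Fr-1 (toℕ i))) (*-identityʳ (f i)))) ⟩
    ∑[ i < n ] single i (f i) l
      ≈⟨ sum-of-singles f l ⟩
    f l ∎

  ∘-distribˡ : ∀ f g h → f ∘ (g +ᴸ h) ≋ f ∘ g +ᴸ f ∘ h
  ∘-distribˡ f g h l = trans
    (sum-cong-≋ {n} (λ i → trans (sum-cong-≋ {n} (λ j → F-+ (single-isAdditive (i ⊕ j) l (*Fr-isAdditive (f i) (toℕ i))) (g j) (h j)))
                             (∑-distrib-+ {n} _ _)))
    (∑-distrib-+ {n} _ _)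

  ∘-distribʳ : ∀ h f g → (f +ᴸ g) ∘ h ≋ f ∘ h +ᴸ g ∘ h
  ∘-distribʳ h f g l = trans
    (sum-cong-≋ {n} (λ i → trans (sum-cong-≋ {n} (λ j → F-+ (single-isAdditive (i ⊕ j) l (*x-isAdditive (Fr (toℕ i) (h j)))) (f i) (g i)))
                             (∑-distrib-+ {n} _ _)))
    (∑-distrib-+ {n} _ _)

  *ₗ-∘ : ∀ a f g → (a *ₗ f) ∘ g ≋ a *ₗ (f ∘ g)
  *ₗ-∘ a f g l = sym (trans (*-distribˡ-sum {n} a _) (sum-cong-≋ {n} λ i → trans (*-distribˡ-sum {n} a _) (sum-cong-≋ {n} λ j →
    trans (*-single (i ⊕ j) l a _) (single-cong (i ⊕ j) l (sym (*-assoc a (f i) _))))))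

  swap : ∀ x y z → x * (y * z) ≈ y * (x * z)
  swap x y z = trans (sym (*-assoc x y z)) (trans (*-congʳ (*-comm x y)) (*-assoc y x z))

  ∘-ι*ₗ : ∀ s f g → f ∘ (ι s *ₗ g) ≋ ι s *ₗ (f ∘ g)
  ∘-ι*ₗ s f g l = sym (trans (*-distribˡ-sum {n} (ι s) _) (sum-cong-≋ {n} λ i → trans (*-distribˡ-sum {n} (ι s) _) (sum-cong-≋ {n} λ j →
    trans (*-single (i ⊕ j) l (ι s) _) (single-cong (i ⊕ j) l (begin
      ι s * (f i * Fr (toℕ i) (g j))                ≈⟨ swap (ι s) (f i) _ ⟩
      f i * (ι s * Fr (toℕ i) (g j))                ≈⟨ *-congˡ (*-congʳ (Fr-ι (toℕ i) s)) ⟨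
      f i * (Fr (toℕ i) (ι s) * Fr (toℕ i) (g j))   ≈⟨ *-congˡ (Fr-* (toℕ i) (ι s) (g j)) ⟨
      f i * Fr (toℕ i) (ι s * g j)                  ∎)))))

  ℒ-algebra : Algebra F.commutativeRing c′ ℓ′
  ℒ-algebra = record
    { ring = record
      { Carrier = ℒ
      ; _≈_ = _≋_
      ; _+_ = _+ᴸ_
      ; _*_ = _∘_
      ; -_ = λ f i → - f i
      ; 0# = λ _ → 0#
      ; 1# = X
      ; isRing = record
        { +-isAbelianGroup = Pointwise.isAbelianGroup (Fin n) +-isAbelianGroup
        ; *-cong = ∘-cong
        ; *-assoc = ∘-assoc
        ; *-identity = ∘-identityˡ , ∘-identityʳ
        ; distrib = ∘-distribˡ , ∘-distribʳ
        }
      }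
    ; _·_ = λ s f → ι s *ₗ f
    ; isPreleftSemimodule = record
      { *ₗ-cong = λ s≈t f≈g i → *-cong (ι-cong s≈t) (f≈g i)
      ; *ₗ-zeroˡ = λ f i → trans (*-congʳ ι-0) (zeroˡ (f i))
      ; *ₗ-distribʳ = λ f s t i → trans (*-congʳ (ι-+ s t)) (distribʳ (f i) (ι s) (ι t))
      ; *ₗ-identityˡ = λ f i → trans (*-congʳ ι-1) (*-identityˡ (f i))
      ; *ₗ-assoc = λ s t f i → trans (*-congʳ (ι-* s t)) (*-assoc (ι s) (ι t) (f i))
      ; *ₗ-zeroʳ = λ s i → zeroʳ (ι s)
      ; *ₗ-distribˡ = λ s f g i → distribˡ (ι s) (f i) (g i)
      }
    ; ·-*-assocˡ = λ s → *ₗ-∘ (ι s)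
    ; ·-*-assocʳ = ∘-ι*ₗ
    }

  ⟨x⟩ : Pred ℒ (c′ ⊔ ℓ′)
  ⟨x⟩ h = ∃[ a ] h ≋ a *ₗ X

  ⟨x,_⟩ : ℒ → Pred ℒ (c′ ⊔ ℓ′)
  ⟨x, f ⟩ h = ∃[ a ] ∃[ b ] h ≋ a *ₗ X +ᴸ b *ₗ f

  𝒞 : ℒ → Pred ℒ (c′ ⊔ ℓ′)
  𝒞 f = ⟨x, f ⟩

  𝒞-isSubspace : ∀ f → IsSubspace ℒ-algebra (𝒞 f)
  𝒞-isSubspace f = record
    { resp = λ { h≈h′ (a , b , eq) → a , b , λ i → trans (sym (h≈h′ i)) (eq i) }
    ; 0-closed = 0# , 0# , λ i → sym (trans (+-cong (zeroˡ (X i)) (zeroˡ (f i))) (+-identityˡ 0#))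
    ; +-closed = λ { (a , b , eq) (a′ , b′ , eq′) → a + a′ , b + b′ , λ i → begin
        _                                                   ≈⟨ +-cong (eq i) (eq′ i) ⟩
        (a * X i + b * f i) + (a′ * X i + b′ * f i)         ≈⟨ +-assoc _ _ _ ⟩
        a * X i + (b * f i + (a′ * X i + b′ * f i))         ≈⟨ +-congˡ (sym (+-assoc _ _ _)) ⟩
        a * X i + ((b * f i + a′ * X i) + b′ * f i)         ≈⟨ +-congˡ (+-congʳ (+-comm _ _)) ⟩
        a * X i + ((a′ * X i + b * f i) + b′ * f i)         ≈⟨ +-congˡ (+-assoc _ _ _) ⟩
        a * X i + (a′ * X i + (b * f i + b′ * f i))         ≈⟨ +-assoc _ _ _ ⟨
        (a * X i + a′ * X i) + (b * f i + b′ * f i)         ≈⟨ +-cong (distribʳ (X i) a a′) (distribʳ (f i) b b′) ⟨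
        (a + a′) * X i + (b + b′) * f i                     ∎ }
    ; ·-closed = λ { s (a , b , eq) → ι s * a , ι s * b , λ i → begin
        _                                      ≈⟨ *-congˡ (eq i) ⟩
        ι s * (a * X i + b * f i)              ≈⟨ distribˡ (ι s) _ _ ⟩
        ι s * (a * X i) + ι s * (b * f i)      ≈⟨ +-cong (*-assoc (ι s) a (X i)) (*-assoc (ι s) b (f i)) ⟨
        ι s * a * X i + ι s * b * f i          ∎ }
    }

  R : ∀ {p} (C : Pred ℒ p) → IsSubspace ℒ-algebra C → Algebra F.commutativeRing (c′ ⊔ p) ℓ′
  R C C-sub = subalgebra ℒ-algebra (rightIdealizer ℒ-algebra C) (rightIdealizer-isSubalgebra ℒ-algebra C-sub)

  matrixAlgebra : Algebra F.commutativeRing c′ ℓ′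
  matrixAlgebra = record
    { ring = record { isRing = matrix-isRing 2 }
    ; _·_ = λ s A i j → ι s * A i j
    ; isPreleftSemimodule = record
      { *ₗ-cong = λ s≈t A≈B i j → *-cong (ι-cong s≈t) (A≈B i j)
      ; *ₗ-zeroˡ = λ A i j → trans (*-congʳ ι-0) (zeroˡ (A i j))
      ; *ₗ-distribʳ = λ A s t i j → trans (*-congʳ (ι-+ s t)) (distribʳ (A i j) (ι s) (ι t))
      ; *ₗ-identityˡ = λ A i j → trans (*-congʳ ι-1) (*-identityˡ (A i j))
      ; *ₗ-assoc = λ s t A i j → trans (*-congʳ (ι-* s t)) (*-assoc (ι s) (ι t) (A i j))
      ; *ₗ-zeroʳ = λ s i j → zeroʳ (ι s)
      ; *ₗ-distribˡ = λ s A B i j → distribˡ (ι s) (A i j) (B i j)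
      }
    ; ·-*-assocˡ = λ s A B i l → *ᵥ-scaleˡ (ι s) A (λ j → B j l) i
    ; ·-*-assocʳ = λ s A B i l → *ᵥ-scaleʳ (ι s) A (λ j → B j l) i
    }

  𝒢 : ℒ → Pred (Vector K 2) (c′ ⊔ ℓ′)
  𝒢 f v = ∃[ y ] v ≋ (y ∷ eval f y ∷ [])

  image : Matrix 2 → Pred (Vector K 2) (c′ ⊔ ℓ′) → Pred (Vector K 2) (c′ ⊔ ℓ′)
  image A P w = ∃[ v ] (v ∈ P × w ≋ A *ᵥ v)

  Stabilizes : ℒ → Pred (Matrix 2) (c′ ⊔ ℓ′)
  Stabilizes f A = image A (𝒢 f) ⊆ 𝒢 f

  eval-isAdditive : ∀ f → IsAdditive (eval f)
  eval-isAdditive f = sum-isAdditive (λ i → *Fr-isAdditive (f i) (toℕ i))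

  eval-ι : ∀ f s y → eval f (ι s * y) ≈ ι s * eval f y
  eval-ι f s y = trans (sum-cong-≋ {n} (λ i → begin
      f i * Fr (toℕ i) (ι s * y)               ≈⟨ *-congˡ (Fr-* (toℕ i) (ι s) y) ⟩
      f i * (Fr (toℕ i) (ι s) * Fr (toℕ i) y)  ≈⟨ *-congˡ (*-congʳ (Fr-ι (toℕ i) s)) ⟩
      f i * (ι s * Fr (toℕ i) y)               ≈⟨ swap (f i) (ι s) _ ⟩
      ι s * (f i * Fr (toℕ i) y)               ∎))
    (sym (*-distribˡ-sum {n} (ι s) _))

  𝒢-resp : ∀ f {u v} → u ≋ v → u ∈ 𝒢 f → v ∈ 𝒢 f
  𝒢-resp f u≈v (y , eq) = y , λ i → trans (sym (u≈v i)) (eq i)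

  𝒢-+ : ∀ f {u v} → u ∈ 𝒢 f → v ∈ 𝒢 f → (λ i → u i + v i) ∈ 𝒢 f
  𝒢-+ f (y , eq) (z , eq′) = y + z , λ where
    zero       → +-cong (eq zero) (eq′ zero)
    (suc zero) → trans (+-cong (eq (suc zero)) (eq′ (suc zero))) (sym (F-+ (eval-isAdditive f) y z))

  𝒢-ι : ∀ f s {u} → u ∈ 𝒢 f → (λ i → ι s * u i) ∈ 𝒢 f
  𝒢-ι f s (y , eq) = ι s * y , λ where
    zero       → *-congˡ (eq zero)
    (suc zero) → trans (*-congˡ (eq (suc zero))) (sym (eval-ι f s y))

  𝒢-0 : ∀ f → (λ _ → 0#) ∈ 𝒢 f
  𝒢-0 f = 0# , λ where
    zero       → refl
    (suc zero) → sym (F-0 (eval-isAdditive f))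

  Stabilizes-isSubalgebra : ∀ f → IsSubalgebra matrixAlgebra (Stabilizes f)
  Stabilizes-isSubalgebra f = record
    { isSubspace = record
      { resp = λ A≈B A∈S (v , v∈G , w≈) →
          A∈S (v , v∈G , λ i → trans (w≈ i) (sym (*ᵥ-cong {u = v} A≈B (λ _ → refl) i)))
      ; 0-closed = λ (v , v∈G , w≈) →
          𝒢-resp f (λ i → sym (trans (w≈ i) (trans (sum-cong-≋ {2} (λ j → zeroˡ (v j))) (sum-replicate-zero 2)))) (𝒢-0 f)
      ; +-closed = λ {A} {B} A∈S B∈S (v , v∈G , w≈) →
          𝒢-resp f (λ i → sym (trans (w≈ i) (*ᵥ-distribʳ A B v i)))
            (𝒢-+ f (A∈S (v , v∈G , λ _ → refl)) (B∈S (v , v∈G , λ _ → refl)))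
      ; ·-closed = λ s {A} A∈S (v , v∈G , w≈) →
          𝒢-resp f (λ i → sym (trans (w≈ i) (*ᵥ-scaleˡ (ι s) A v i)))
            (𝒢-ι f s (A∈S (v , v∈G , λ _ → refl)))
      }
    ; 1-closed = λ (v , v∈G , w≈) → 𝒢-resp f {v} (λ i → sym (trans (w≈ i) (1ᴹ*ᵥ v i))) v∈G
    ; *-closed = λ {A} {B} A∈S B∈S (v , v∈G , w≈) →
        𝒢-resp f (λ i → sym (trans (w≈ i) (*ᵥ-assoc A B v i)))
          (A∈S (B *ᵥ v , B∈S (v , v∈G , λ _ → refl) , λ _ → refl))
    }

  𝕊 : ℒ → Algebra F.commutativeRing (c′ ⊔ ℓ′) ℓ′
  𝕊 f = subalgebra matrixAlgebra (Stabilizes f) (Stabilizes-isSubalgebra f)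

{-# OPTIONS --safe #-}

-- The isomorphism sends A ∈ 𝕊_f to g = A₀₀ x + A₀₁ f, the map induced by A on first coordinates of 𝒢_f.
-- Comparing second coordinates, A stabilises 𝒢_f iff f ∘ g = A₁₀ x + A₁₁ f as functions, hence as
-- polynomials, since a nonzero q-polynomial of degree < q^n cannot vanish on all of 𝔽_{q^n}.
-- So the rows of A express x ∘ g and f ∘ g in terms of x and f, which are linearly independent:
-- such A correspond exactly to the g in the right idealizer of ⟨x, f⟩.
module Submission where

open import Level using (Level)
import Algebra.Properties.CommutativeSemiring.Exp as Exponentiation
import Algebra.Properties.Group as GroupProperties
import Algebra.Properties.Ring as RingProperties
import Algebra.Properties.Semiring.Sum as SemiringSum
import Algebra.Solver.Ring.NaturalCoefficients.Default as SemiringSolver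
open import Data.Empty using (⊥-elim)
open import Data.Fin.Base using (Fin; zero; suc; toℕ; fromℕ<)
import Data.Fin.Properties as Fin
open import Data.Nat.Base as ℕ using (ℕ; zero; suc; NonZero)
open import Data.Nat.DivMod using (_mod_)
open import Data.Nat.Primality using (prime⇒nonZero; prime⇒nonTrivial)
import Data.Nat.Properties as ℕ
open import Data.Product.Base using (_,_; proj₁; proj₂)
open import Data.Vec.Functional using (Vector; _∷_; [])
open import Function.Bundles using (Inverse)
open import Function.Definitions using (Surjective)
open import Relation.Binary.PropositionalEquality as ≡ using (_≡_)
import Relation.Binary.Reasoning.Setoid as SetoidReasoning
open import Relation.Nullary using (yes; no)
open import Relation.Unary using (_∈_; _∉_)
open import Defs

-- This makes `q ^ i` strictly increasing in `i`, so the exponents of a q-polynomial are distinct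
-- and lie below `q ^ n`.
primePower>1 : ∀ {q} → IsPrimePower q → 1 ℕ.< q
primePower>1 (p , suc k , p-prime , _ , ≡.refl) =
  ℕ.<-≤-trans (ℕ.nonTrivial⇒n>1 p) (ℕ.m≤m*n p (p ℕ.^ k))
  where
  instance
    p-nonTrivial = prime⇒nonTrivial p-prime
    p-nonZero = prime⇒nonZero p-prime
    pᵏ-nonZero = ℕ.m^n≢0 p k

-- Counting roots of polynomials over a finite field.

module RootCounting {c ℓ N} (𝔽 : FiniteField c ℓ N) where
  open FiniteField 𝔽 hiding (zero)
  open FiniteFieldProperties 𝔽 using (_≟_; *-cancelʳ)
  open Exponentiation commutativeSemiring
  open SemiringSum semiring
  open SemiringSolver commutativeSemiring using (solve; _:=_; _:+_; _:*_)
  open SetoidReasoning setoid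

  poly : ∀ {m} → Vector Carrier m → Carrier → Carrier
  poly {m} c y = ∑[ k < m ] (c k * y ^ toℕ k)

  private
    tail : ∀ {m} → Vector Carrier (suc m) → Vector Carrier m
    tail c k = c (suc k)

  poly-suc : ∀ {m} (c : Vector Carrier (suc m)) y → poly c y ≈ c zero + y * poly (tail c) y
  poly-suc {m} c y = +-cong (*-identityʳ (c zero)) (begin
    ∑[ k < m ] (c (suc k) * (y * y ^ toℕ k))   ≈⟨ sum-cong-≋ {m} (λ k → solve 3 (λ a b d → a :* (b :* d) := b :* (a :* d)) refl
                                                   (c (suc k)) y (y ^ toℕ k)) ⟩
    ∑[ k < m ] (y * (c (suc k) * y ^ toℕ k))   ≈⟨ *-distribˡ-sum {m} y _ ⟨
    y * poly (tail c) y                        ∎)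

  -- Synthetic division: the quotient of c by y − a.
  quotient : ∀ {m} → Carrier → Vector Carrier (suc m) → Vector Carrier m
  quotient a c zero    = poly (tail c) a
  quotient a c (suc k) = quotient a (tail c) k

  -- c(y) = c(a) + (y − a) quotient(y), with both sides moved so that no subtraction occurs.
  quotient-correct : ∀ {m} a (c : Vector Carrier (suc m)) y →
                     poly c y + a * poly (quotient a c) y ≈ poly c a + y * poly (quotient a c) y
  quotient-correct {zero}  a c y = +-congˡ (trans (zeroʳ a) (sym (zeroʳ y)))
  quotient-correct {suc m} a c y = begin
    poly c y + a * poly (quotient a c) y
      ≈⟨ +-cong (poly-suc c y) (*-congˡ (poly-suc (quotient a c) y)) ⟩
    (c₀ + y * Py) + a * (Pa + y * Q)
      ≈⟨ solve 6 (λ c₀ y Py a Pa Q → (c₀ :+ y :* Py) :+ a :* (Pa :+ y :* Q)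
                   := (c₀ :+ a :* Pa) :+ y :* (Py :+ a :* Q)) refl c₀ y Py a Pa Q ⟩
    (c₀ + a * Pa) + y * (Py + a * Q)
      ≈⟨ +-cong (sym (poly-suc c a)) (*-congˡ (quotient-correct a (tail c) y)) ⟩
    poly c a + y * (Pa + y * Q)
      ≈⟨ +-congˡ (*-congˡ (poly-suc (quotient a c) y)) ⟨
    poly c a + y * poly (quotient a c) y ∎
    where
    c₀ = c zero
    Py = poly (tail c) y
    Pa = poly (tail c) a
    Q  = poly (quotient a (tail c)) y

  -- The first coefficient of the quotient is the value of `tail c` at `a`, and the others form the
  -- quotient of `tail c`. If they vanish, induction applies to `tail c`, and `c zero` reduces to
  -- `poly c a`.
  quotient≈0⇒≈0 : ∀ {m} a (c : Vector Carrier (suc m)) → poly c a ≈ 0# →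
                  (∀ k → quotient a c k ≈ 0#) → ∀ k → c k ≈ 0#
  quotient≈0⇒≈0 {zero} a c c[a]≈0 _ zero =
    trans (sym (trans (+-identityʳ _) (*-identityʳ (c zero)))) c[a]≈0
  quotient≈0⇒≈0 {suc m} a c c[a]≈0 q≈0 zero = begin
    c zero                          ≈⟨ +-identityʳ _ ⟨
    c zero + 0#                     ≈⟨ +-congˡ (trans (*-congˡ (q≈0 zero)) (zeroʳ a)) ⟨
    c zero + a * poly (tail c) a    ≈⟨ poly-suc c a ⟨
    poly c a                        ≈⟨ c[a]≈0 ⟩
    0#                              ∎
  quotient≈0⇒≈0 {suc m} a c c[a]≈0 q≈0 (suc k) =
    quotient≈0⇒≈0 a (tail c) (q≈0 zero) (λ k → q≈0 (suc k)) k

  -- Dividing by `y − a₀` removes one coefficient and one root, so induction applies to the quotient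
  -- and the remaining roots.
  roots⇒≈0 : ∀ {m} (c a : Vector Carrier m) → (∀ {i j} → a i ≈ a j → i ≡ j) →
             (∀ i → poly c (a i) ≈ 0#) → ∀ k → c k ≈ 0#
  roots⇒≈0 {suc m} c a a-inj root = quotient≈0⇒≈0 a₀ c (root zero)
    (roots⇒≈0 (quotient a₀ c) (tail a) (λ eq → Fin.suc-injective (a-inj eq)) quotient-root)
    where
    a₀ = a zero
    Q : Carrier → Carrier
    Q = poly (quotient a₀ c)

    quotient-root : ∀ i → Q (a (suc i)) ≈ 0#
    quotient-root i with Q (a (suc i)) ≟ 0#
    ... | yes Q≈0 = Q≈0
    -- Since `c` vanishes at both points, the division identity becomes `a₀ * Q y ≈ y * Q y`;
    -- cancelling `Q y` would identify two distinct roots.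
    ... | no  Q≉0 = ⊥-elim (Fin.0≢1+n (a-inj (*-cancelʳ Q≉0 (begin
      a₀ * Q y                  ≈⟨ +-identityˡ _ ⟨
      0# + a₀ * Q y             ≈⟨ +-congʳ (root (suc i)) ⟨
      poly c y + a₀ * Q y       ≈⟨ quotient-correct a₀ c y ⟩
      poly c a₀ + y * Q y       ≈⟨ +-congʳ (root zero) ⟩
      0# + y * Q y              ≈⟨ +-identityˡ _ ⟩
      y * Q y                   ∎))))
      where y = a (suc i)

  -- The enumeration of the field supplies `N` distinct roots against `N` coefficients.
  poly≈0⇒≈0 : (c : Vector Carrier N) → (∀ y → poly c y ≈ 0#) → ∀ k → c k ≈ 0#
  poly≈0⇒≈0 c vanish = roots⇒≈0 c to to-injective (λ i → vanish (to i))
    where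
    open Inverse enumeration using (to; from-cong; inverseʳ)
    to-injective : ∀ {i j} → to i ≈ to j → i ≡ j
    to-injective eq = ≡.trans (≡.sym (inverseʳ refl)) (≡.trans (from-cong eq) (inverseʳ refl))

module _ {c ℓ c′ ℓ′ : Level} {q : ℕ} (q-primePower : IsPrimePower q)
         (n : ℕ) .{{n≢0 : NonZero n}} (𝔼 : FiniteFieldExtension c ℓ c′ ℓ′ q n) where
  open FiniteFieldExtension 𝔼
  open LinearizedPolynomials q-primePower n 𝔼
  open FiniteField 𝔽qⁿ hiding (zero) renaming (Carrier to K)
  open FiniteFieldProperties 𝔽qⁿ using (_≟_)
  open Exponentiation commutativeSemiring using (_^_)
  open SemiringSum semiring
  open Matrices commutativeRing
  open GroupProperties +-group using (inverseʳ-unique; x∙y⁻¹≈ε⇒x≈y)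
  open RingProperties (FiniteField.ring 𝔽qⁿ) using (-‿distribˡ-*; -‿distribʳ-*; -‿+-comm)
  open SemiringSolver commutativeSemiring using (solve; _:=_; _:+_; _:*_; con)
  open SetoidReasoning setoid

  -- A q-polynomial is determined by its values.

  eval-+ᴸ : ∀ f g y → eval (f +ᴸ g) y ≈ eval f y + eval g y
  eval-+ᴸ f g y = trans (sum-cong-≋ {n} (λ i → distribʳ _ (f i) (g i))) (∑-distrib-+ {n} _ _)

  eval-*ₗ : ∀ a f y → eval (a *ₗ f) y ≈ a * eval f y
  eval-*ₗ a f y = trans (sum-cong-≋ {n} (λ i → *-assoc a (f i) _)) (sym (*-distribˡ-sum {n} a _))

  eval-cong : ∀ {f g} → f ≋ g → ∀ y → eval f y ≈ eval g y
  eval-cong f≈g y = sum-cong-≋ {n} (λ i → *-congʳ (f≈g i))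

  private
    q^toℕ<q^n : (i : Fin n) → q ℕ.^ toℕ i ℕ.< q ℕ.^ n
    q^toℕ<q^n i = ℕ.^-monoʳ-< q (primePower>1 q-primePower) (Fin.toℕ<n i)

    position : Fin n → Fin (q ℕ.^ n)
    position i = fromℕ< (q^toℕ<q^n i)

    toℕ-position : ∀ i → toℕ (position i) ≡ q ℕ.^ toℕ i
    toℕ-position i = Fin.toℕ-fromℕ< (q^toℕ<q^n i)

    position-injective : ∀ {i j} → position i ≡ position j → i ≡ j
    position-injective {i} {j} eq = Fin.toℕ-injective (ℕ.≤-antisym (le eq) (le (≡.sym eq)))
      where
      le : ∀ {i j} → position i ≡ position j → toℕ i ℕ.≤ toℕ j
      le {i} {j} eq = ℕ.≮⇒≥ λ j<i → ℕ.<-irrefl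
        (≡.trans (≡.sym (toℕ-position j)) (≡.trans (≡.cong toℕ (≡.sym eq)) (toℕ-position i)))
        (ℕ.^-monoʳ-< q (primePower>1 q-primePower) j<i)

  -- The same polynomial as an ordinary one: there are now as many coefficients as field elements,
  -- which is the shape root counting needs.
  dense : ℒ → Vector K (q ℕ.^ n)
  dense f k = ∑[ i < n ] single (position i) (f i) k

  poly-dense : ∀ f y → RootCounting.poly 𝔽qⁿ (dense f) y ≈ eval f y
  poly-dense f y = begin
    ∑[ k < q ℕ.^ n ] (dense f k * y ^ toℕ k)
      ≈⟨ sum-cong-≋ {q ℕ.^ n} (λ k → *-distribʳ-sum {n} (y ^ toℕ k) _) ⟩
    ∑[ k < q ℕ.^ n ] ∑[ i < n ] (single (position i) (f i) k * y ^ toℕ k)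
      ≈⟨ ∑-comm {q ℕ.^ n} {n} _ ⟩
    ∑[ i < n ] ∑[ k < q ℕ.^ n ] (single (position i) (f i) k * y ^ toℕ k)
      ≈⟨ sum-cong-≋ {n} (λ i → sum-single (λ k → *x-isAdditive (y ^ toℕ k)) (position i) (f i)) ⟩
    ∑[ i < n ] (f i * y ^ toℕ (position i))
      ≈⟨ sum-cong-≋ {n} (λ i → *-congˡ (reflexive (≡.cong (y ^_) (toℕ-position i)))) ⟩
    eval f y ∎

  dense-position : ∀ f i → dense f (position i) ≈ f i
  dense-position f i = trans
    (sum-only i _ (λ j i≢j → single-off (position j) (position i) (f j)
      (λ eq → i≢j (≡.sym (position-injective eq)))))
    (single-on (position i) (f i))

  -- All `q ^ n` field elements are roots of `dense f`, whose degree is below `q ^ n`; each `f i` is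
  -- one of its coefficients.
  eval≈0⇒≈0 : ∀ f → (∀ y → eval f y ≈ 0#) → ∀ i → f i ≈ 0#
  eval≈0⇒≈0 f vanish i = trans (sym (dense-position f i))
    (RootCounting.poly≈0⇒≈0 𝔽qⁿ (dense f) (λ y → trans (poly-dense f y) (vanish y)) (position i))

  -- The difference is written with the scalar `- 1#` so that linearity of evaluation reduces the
  -- claim to a vanishing polynomial.
  eval-injective : ∀ f g → (∀ y → eval f y ≈ eval g y) → f ≋ g
  eval-injective f g eq i = x∙y⁻¹≈ε⇒x≈y _ _ (trans (+-congˡ (sym (neg (g i))))
    (eval≈0⇒≈0 (f +ᴸ (- 1#) *ₗ g) difference i))
    where
    neg : ∀ x → - 1# * x ≈ - x
    neg x = trans (sym (-‿distribˡ-* 1# x)) (-‿cong (*-identityˡ x))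
    difference : ∀ y → eval (f +ᴸ (- 1#) *ₗ g) y ≈ 0#
    difference y = begin
      eval (f +ᴸ (- 1#) *ₗ g) y         ≈⟨ eval-+ᴸ f _ y ⟩
      eval f y + eval ((- 1#) *ₗ g) y   ≈⟨ +-cong (eq y) (trans (eval-*ₗ (- 1#) g y) (neg _)) ⟩
      eval g y + - eval g y             ≈⟨ -‿inverseʳ _ ⟩
      0#                                ∎

  -- Coordinates with respect to x and f, and the stabiliser condition.

  module _ (f : ℒ) where

    -- The coordinates form a vector so that a row of a matrix can be inserted directly.
    combination : Vector K 2 → ℒ
    combination v = v zero *ₗ X +ᴸ v (suc zero) *ₗ f

    combination-cong : ∀ {u v} → u ≋ v → combination u ≋ combination v
    combination-cong u≈v i = +-cong (*-congʳ (u≈v zero)) (*-congʳ (u≈v (suc zero)))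

    eval-combination : ∀ v y → eval (combination v) y ≈ v zero * y + v (suc zero) * eval f y
    eval-combination v y = trans (eval-+ᴸ (v zero *ₗ X) _ y)
      (+-cong (trans (eval-*ₗ (v zero) X y) (*-congˡ (eval-X y))) (eval-*ₗ (v (suc zero)) f y))

    combination-∘ : ∀ v g → combination v ∘ g ≋ v zero *ₗ g +ᴸ v (suc zero) *ₗ (f ∘ g)
    combination-∘ v g i = trans (∘-distribʳ g (v zero *ₗ X) (v (suc zero) *ₗ f) i)
      (+-cong (trans (*ₗ-∘ (v zero) X g i) (*-congˡ (∘-identityˡ g i))) (*ₗ-∘ (v (suc zero)) f g i))

    -- The coordinate vector on the left is the row vector `v` times `A`; this is the source of
    -- multiplicativity.
    combination-row : ∀ (v : Vector K 2) (A : Matrix 2) →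
      combination (λ l → ∑[ j < 2 ] (v j * A j l)) ≋ v zero *ₗ combination (A zero) +ᴸ v (suc zero) *ₗ combination (A (suc zero))
    combination-row v A i = solve 8
      -- Each `con 0` is the final `0#` of a sum over two indices.
      (λ a b p q r s x y → (a :* p :+ (b :* r :+ con 0)) :* x :+ (a :* q :+ (b :* s :+ con 0)) :* y
         := a :* (p :* x :+ q :* y) :+ b :* (r :* x :+ s :* y)) refl
      (v zero) (v (suc zero)) (A zero zero) (A zero (suc zero)) (A (suc zero) zero) (A (suc zero) (suc zero)) (X i) (f i)

    combination-+ : ∀ u v → combination (λ l → u l + v l) ≋ combination u +ᴸ combination v
    combination-+ u v i = solve 6
      (λ a b a′ b′ x y → (a :+ a′) :* x :+ (b :+ b′) :* y := (a :* x :+ b :* y) :+ (a′ :* x :+ b′ :* y)) refl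
      (u zero) (u (suc zero)) (v zero) (v (suc zero)) (X i) (f i)

    combination-*ₗ : ∀ s v → combination (λ l → s * v l) ≋ s *ₗ combination v
    combination-*ₗ s v i = solve 5
      (λ s a b x y → (s :* a) :* x :+ (s :* b) :* y := s :* (a :* x :+ b :* y)) refl
      s (v zero) (v (suc zero)) (X i) (f i)

    combination-‿ : ∀ v i → combination (λ l → - v l) i ≈ - combination v i
    combination-‿ v i = trans (+-cong (sym (-‿distribˡ-* _ _)) (sym (-‿distribˡ-* _ _))) (-‿+-comm _ _)

    combination-0 : ∀ i → combination (λ _ → 0#) i ≈ 0#
    combination-0 i = trans (+-cong (zeroˡ (X i)) (zeroˡ (f i))) (+-identityˡ 0#)

    -- Let `g` and `h` be the combinations given by the rows of `A`. Then `A` sends `(y, f(y))` to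
    -- `(g(y), h(y))`, which lies on the graph only if `h(y) = f(g(y))`. This holds for every `y`,
    -- so `eval-injective` applies.
    stabilizes⇒ : ∀ A → A ∈ Stabilizes f → combination (A (suc zero)) ≋ f ∘ combination (A zero)
    stabilizes⇒ A A∈S = eval-injective _ _ pointwise
      where
      coordinate : ∀ i y → eval (combination (A i)) y ≈ A i zero * y + (A i (suc zero) * eval f y + 0#)
      coordinate i y = trans (eval-combination (A i) y) (+-congˡ (sym (+-identityʳ _)))

      pointwise : ∀ y → eval (combination (A (suc zero))) y ≈ eval (f ∘ combination (A zero)) y
      -- The first coordinate of `eq` identifies the abscissa `z` with `g(y)`.
      pointwise y with A∈S (_ , (y , λ _ → refl) , λ _ → refl)
      ... | z , eq = begin
        eval (combination (A (suc zero))) y       ≈⟨ coordinate (suc zero) y ⟩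
        _                                         ≈⟨ eq (suc zero) ⟩
        eval f z                                  ≈⟨ F-cong (eval-isAdditive f) (trans (coordinate zero y) (eq zero)) ⟨
        eval f (eval (combination (A zero)) y)    ≈⟨ eval-∘ f (combination (A zero)) y ⟨
        eval (f ∘ combination (A zero)) y         ∎

    -- The image of the graph point over `y` is the graph point over the value at `y` of the
    -- first-row combination.
    stabilizes⇐ : ∀ A → combination (A (suc zero)) ≋ f ∘ combination (A zero) → A ∈ Stabilizes f
    stabilizes⇐ A eq {w} (v , (y , v≈) , w≈) = eval (combination (A zero)) y , λ where
        zero       → coordinate zero
        (suc zero) → trans (coordinate (suc zero)) (trans (eval-cong eq y) (eval-∘ f (combination (A zero)) y))
      where
      coordinate : ∀ i → w i ≈ eval (combination (A i)) y
      coordinate i = begin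
        w i                                                     ≈⟨ w≈ i ⟩
        A i zero * v zero + (A i (suc zero) * v (suc zero) + 0#)  ≈⟨ +-cong (*-congˡ (v≈ zero)) (trans (+-identityʳ _) (*-congˡ (v≈ (suc zero)))) ⟩
        A i zero * y + A i (suc zero) * eval f y                ≈⟨ eval-combination (A i) y ⟨
        eval (combination (A i)) y                              ∎

    -- Composing on the right with the first-row combination sends x to the first row and f to the
    -- second, hence acts on coordinates as `v` times `A`. This yields both membership in the
    -- idealizer and multiplicativity.
    stabilizes⇒∘ : ∀ A → A ∈ Stabilizes f → ∀ v →
      combination v ∘ combination (A zero) ≋ combination (λ l → ∑[ j < 2 ] (v j * A j l))
    stabilizes⇒∘ A A∈S v i = begin
      (combination v ∘ combination (A zero)) i
        ≈⟨ combination-∘ v (combination (A zero)) i ⟩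
      v zero * combination (A zero) i + v (suc zero) * (f ∘ combination (A zero)) i
        ≈⟨ +-congˡ (*-congˡ (stabilizes⇒ A A∈S i)) ⟨
      v zero * combination (A zero) i + v (suc zero) * combination (A (suc zero)) i
        ≈⟨ combination-row v A i ⟨
      combination (λ l → ∑[ j < 2 ] (v j * A j l)) i ∎

    -- Linear independence of x and f.

    module _ (f∉⟨x⟩ : f ∉ ⟨x⟩) where

      -- If `b` were nonzero, solving for `f` would give `f = -(a / b) x`, against `f∉⟨x⟩`. With `b`
      -- zero, only `a *ₗ X` remains.
      combination≈0⇒≈0 : ∀ v → (∀ i → combination v i ≈ 0#) → ∀ j → v j ≈ 0#
      combination≈0⇒≈0 v eq = λ where
          zero       → v₀≈0
          (suc zero) → v₁≈0
        where
        a = v zero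
        b = v (suc zero)

        v₁≈0 : b ≈ 0#
        v₁≈0 with b ≟ 0#
        ... | yes b≈0 = b≈0
        ... | no  b≉0 = ⊥-elim (f∉⟨x⟩ (- (w * a) , λ i → begin
          f i                  ≈⟨ *-identityˡ (f i) ⟨
          1# * f i             ≈⟨ *-congʳ (trans (*-comm w b) bw≈1) ⟨
          (w * b) * f i        ≈⟨ *-assoc w b (f i) ⟩
          w * (b * f i)        ≈⟨ *-congˡ (inverseʳ-unique _ _ (eq i)) ⟩
          w * - (a * X i)      ≈⟨ -‿distribʳ-* w _ ⟨
          - (w * (a * X i))    ≈⟨ -‿cong (*-assoc w a (X i)) ⟨
          - ((w * a) * X i)    ≈⟨ -‿distribˡ-* (w * a) (X i) ⟩
          - (w * a) * X i      ∎))
          where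
          w = proj₁ (*-inverse b b≉0)
          bw≈1 = proj₂ (*-inverse b b≉0)

        v₀≈0 : a ≈ 0#
        v₀≈0 = begin
          a                          ≈⟨ *-identityʳ a ⟨
          a * 1#                     ≈⟨ *-congˡ (single-on o 1#) ⟨
          a * X o                    ≈⟨ +-identityʳ _ ⟨
          a * X o + 0#               ≈⟨ +-congˡ (trans (*-congʳ v₁≈0) (zeroˡ (f o))) ⟨
          a * X o + b * f o          ≈⟨ eq o ⟩
          0#                         ∎
          -- The index of the exponent `q ^ 0`, where `X` has coefficient `1#`.
          where o = 0 mod n

      combination-injective : ∀ u v → combination u ≋ combination v → u ≋ v
      combination-injective u v eq j = x∙y⁻¹≈ε⇒x≈y _ _ (combination≈0⇒≈0 (λ l → u l + - v l) (λ i → begin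
        combination (λ l → u l + - v l) i             ≈⟨ combination-+ u (λ l → - v l) i ⟩
        combination u i + combination (λ l → - v l) i  ≈⟨ +-cong (eq i) (combination-‿ v i) ⟩
        combination v i + - combination v i           ≈⟨ -‿inverseʳ _ ⟩
        0#                                            ∎) j)

      -- The algebra isomorphism.

      𝕊≅R : 𝕊 f ≅ R (𝒞 f) (𝒞-isSubspace f)
      𝕊≅R = φ , record
        { isRingIsomorphism = record
          { isRingMonomorphism = record
            { isRingHomomorphism = record
              { isSemiringHomomorphism = record
                { isNearSemiringHomomorphism = record
                  { +-isMonoidHomomorphism = record
                    { isMagmaHomomorphism = record
                      { isRelHomomorphism = record { cong = λ A≈B → combination-cong (A≈B zero) }
                      ; homo = λ (A , _) (B , _) → combination-+ (A zero) (B zero)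
                      }
                    ; ε-homo = combination-0
                    }
                  -- The first row of the product is the first row of `A` times `B`.
                  ; *-homo = λ (A , _) (B , B∈S) i → sym (stabilizes⇒∘ B B∈S (A zero) i)
                  }
                ; 1#-homo = 1-homo
                }
              ; -‿homo = λ (A , _) → combination-‿ (A zero)
              }
            ; injective = λ {A} {B} → φ-injective {A} {B}
            }
          ; surjective = φ-surjective
          }
        ; ·-homo = λ s (A , _) → combination-*ₗ (ι s) (A zero)
        }
        where
        open Algebra (𝕊 f) using () renaming (Carrier to 𝕊f; _≈_ to _≈𝕊_)
        open Algebra (R (𝒞 f) (𝒞-isSubspace f)) using () renaming (Carrier to Rf; _≈_ to _≈R_)

        φ : 𝕊f → Rf
        φ (A , A∈S) = combination (A zero) , λ where
          -- The new coordinates are `(a, b)` times `A`; unification reads them off `stabilizes⇒∘`.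
          (a , b , h≈) → _ , _ , λ i →
            trans (∘-cong {g = combination (A zero)} h≈ (λ _ → refl) i)
                  (stabilizes⇒∘ A A∈S (a ∷ b ∷ []) i)

        1-homo : combination (1ᴹ zero) ≋ X
        1-homo i = trans (+-cong (*-identityˡ (X i)) (zeroˡ (f i))) (+-identityʳ (X i))

        x∈𝒞 : X ∈ 𝒞 f
        x∈𝒞 = 1# , 0# , λ i → sym (1-homo i)

        f∈𝒞 : f ∈ 𝒞 f
        f∈𝒞 = 0# , 1# , λ i → sym (trans (+-cong (zeroˡ (X i)) (*-identityˡ (f i))) (+-identityˡ (f i)))

        -- Independence recovers the first row. It fixes `f ∘ g`, whose coordinates are the second
        -- row, so independence recovers that row too.
        φ-injective : ∀ {A B : 𝕊f} → φ A ≈R φ B → A ≈𝕊 B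
        φ-injective {A , A∈S} {B , B∈S} eq = λ where
          zero       → combination-injective (A zero) (B zero) eq
          (suc zero) → combination-injective (A (suc zero)) (B (suc zero)) λ i → begin
            combination (A (suc zero)) i      ≈⟨ stabilizes⇒ A A∈S i ⟩
            (f ∘ combination (A zero)) i      ≈⟨ ∘-cong {f} {f} (λ _ → refl) eq i ⟩
            (f ∘ combination (B zero)) i      ≈⟨ stabilizes⇒ B B∈S i ⟨
            combination (B (suc zero)) i      ∎

        -- Applying the idealizer condition to x and f gives coordinates of `X ∘ g` and `f ∘ g`,
        -- taken as the rows of `A`. The first row then represents `g`, and the second gives exactly
        -- the stabiliser condition.
        φ-surjective : Surjective _≈𝕊_ _≈R_ φ
        φ-surjective (g , g∈R) with g∈R {X} x∈𝒞 | g∈R {f} f∈𝒞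
        -- `Surjective` asks that every `B` equal to the preimage `A` be sent to `g`, hence the
        -- argument `B≈A`.
        ... | a , b , x∘g≈ | a′ , b′ , f∘g≈ = (A , stabilizes⇐ A row₁) , λ B≈A i →
            trans (combination-cong (B≈A zero) i) (row₀ i)
          where
          A : Matrix 2
          A zero       = a ∷ b ∷ []
          A (suc zero) = a′ ∷ b′ ∷ []

          row₀ : combination (A zero) ≋ g
          row₀ i = trans (sym (x∘g≈ i)) (∘-identityˡ g i)

          row₁ : combination (A (suc zero)) ≋ f ∘ combination (A zero)
          row₁ i = trans (sym (f∘g≈ i)) (∘-cong {f} {f} (λ _ → refl) (λ j → sym (row₀ j)) i)

theorem4p1 : ∀ {c ℓ c′ ℓ′ : Level} (q : ℕ) (q-primePower : IsPrimePower q) (n : ℕ) .{{n≢0 : NonZero n}}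
    (𝔼 : FiniteFieldExtension c ℓ c′ ℓ′ q n) →
    let open LinearizedPolynomials q-primePower n 𝔼 in
    (f : ℒ) → f ∉ ⟨x⟩ → 𝕊 f ≅ R (𝒞 f) (𝒞-isSubspace f)
theorem4p1 q q-primePower n 𝔼 f f∉⟨x⟩ = 𝕊≅R q-primePower n 𝔼 f f∉⟨x⟩
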